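{- Let $n > 1$ be odd. Let $\gamma_3(n) = 1$ if $n$ is a multiple of $3$, and $\gamma_3(n)=0$ otherwise; let $\delta_3(n) = 1$ if $n$ has a prime factor $p > 3$ with $p \equiv 3 \pmod 4$, and $\delta_3(n)=0$ otherwise; and let $\gamma_5(n)=1$ if $n$ is a multiple of $5$, and $\gamma_5(n)=0$ otherwise. Then $$\mathrm{diam}(G_n) = \begin{cases} 1, & \text{if } n \text{ is prime and } n \equiv 3 \pmod 4;\\ 2, & \text{if } n \text{ is prime and } n\equiv 1 \pmod 4;\\ 2, & \text{if } \omega(n)=1 \text{ and } n \text{ is composite};\\ 2 + \gamma_3(n)\delta_3(n) + \gamma_5(n), & \text{if } \omega(n) > 1.\end{cases}$$ In particular, $\mathrm{diam}(G_n) \le 4$.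
   Context: For an integer $n \ge 1$, $Q_n = \{u^2 : u \in \mathbb{Z}_n^\times\}$ and $T_n = \pm Q_n = \{\pm u^2 : u \in \mathbb{Z}_n^\times\}$. The quadratic unitary Cayley graph $G_n = \mathrm{Cay}(\mathbb{Z}_n, T_n)$ is the undirected graph with vertex set $\mathbb{Z}_n$ in which $a,b$ are adjacent iff $a-b \in T_n$. $\mathrm{diam}$ denotes the graph diameter, and $\omega(n)$ the number of distinct prime factors of $n$. -}

module Defs where

open import Algebra.Bundles using (CommutativeRing)
open import Algebra.Consequences.Propositional
  using (comm∧idˡ⇒id; comm∧invˡ⇒inv; comm∧distrˡ⇒distrʳ)
open import Algebra.Definitions using (Invertible)
open import Algebra.Structures using (IsCommutativeRing)
import Algebra.Properties.Ring as RingProperties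
open import Data.Bool using (if_then_else_)
open import Data.Fin using (Fin; toℕ)
open import Data.Fin.Properties
  using (fromℕ<-cong; fromℕ<-toℕ; toℕ-fromℕ<; toℕ<n; toℕ≤n)
open import Data.List using (List; filter; length; upTo)
open import Data.List.Relation.Unary.Any using (any?)
import Data.Nat as ℕ
open import Data.Nat using (ℕ; suc; _∸_; _%_; _≤_; _≟_; _<?_; NonZero)
open import Data.Nat.DivMod
  using (_mod_; m%n<n; m<n⇒m%n≡m; [m+n]%n≡m%n; %-distribˡ-+; %-distribˡ-*)
open import Data.Nat.Divisibility using (_∣_; _∣?_)
open import Data.Nat.Primality using (prime?)
import Data.Nat.Properties as ℕₚ
open import Data.Product using (_×_; _,_; ∃-syntax)
open import Data.Sum using (_⊎_; inj₁; inj₂)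
open import Level using (0ℓ)
open import Relation.Binary.PropositionalEquality
  using (_≡_; refl; sym; trans; cong; cong₂; subst; isEquivalence; module ≡-Reasoning)
open import Relation.Nullary using (Dec; does)
open import Relation.Nullary.Decidable using (_×-dec_)

record Graph : Set₁ where
  field
    Vertex : Set
    _~_    : Vertex → Vertex → Set
    ~-sym  : ∀ {u v} → u ~ v → v ~ u

module _ (G : Graph) where
  open Graph G

  data Walk : Vertex → Vertex → ℕ → Set where
    []  : ∀ {u} → Walk u u 0
    _∷_ : ∀ {u v w k} → u ~ v → Walk v w k → Walk u w (suc k)

  -- A walk of minimal length is a path, so walks may repeat vertices here.
  IsDistance : Vertex → Vertex → ℕ → Set
  IsDistance u v d = Walk u v d × (∀ k → Walk u v k → d ≤ k)

  -- The maximum of the distances between vertices; in particular, a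
  -- graph with a diameter in this sense is connected.
  IsDiameter : ℕ → Set
  IsDiameter d =
    (∀ u v → ∃[ k ] (IsDistance u v k × k ≤ d)) ×
    (∃[ u ] ∃[ v ] IsDistance u v d)

module Mod (n : ℕ) .{{_ : NonZero n}} where

  infixl 6 _+_
  infixl 7 _*_
  infix  8 -_

  _+_ _*_ : Fin n → Fin n → Fin n
  a + b = (toℕ a ℕ.+ toℕ b) mod n
  a * b = (toℕ a ℕ.* toℕ b) mod n

  -_ : Fin n → Fin n
  - a = (n ∸ toℕ a) mod n

  0# 1# : Fin n
  0# = 0 mod n
  1# = 1 mod n

  mod-cong : ∀ {x y} → x % n ≡ y % n → x mod n ≡ y mod n
  mod-cong {x} {y} eq = fromℕ<-cong _ _ eq (m%n<n x n) (m%n<n y n)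

  toℕ-mod : ∀ x → toℕ (x mod n) ≡ x % n
  toℕ-mod x = toℕ-fromℕ< (m%n<n x n)

  mod-toℕ : ∀ a → toℕ a mod n ≡ a
  mod-toℕ a = trans
    (fromℕ<-cong _ _ (m<n⇒m%n≡m (toℕ<n a)) (m%n<n (toℕ a) n) (toℕ<n a))
    (fromℕ<-toℕ a (toℕ<n a))

  mod-+ : ∀ x y → x mod n + y mod n ≡ (x ℕ.+ y) mod n
  mod-+ x y = mod-cong (trans
    (cong (_% n) (cong₂ ℕ._+_ (toℕ-mod x) (toℕ-mod y)))
    (sym (%-distribˡ-+ x y n)))

  mod-* : ∀ x y → (x mod n) * (y mod n) ≡ (x ℕ.* y) mod n
  mod-* x y = mod-cong (trans
    (cong (_% n) (cong₂ ℕ._*_ (toℕ-mod x) (toℕ-mod y)))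
    (sym (%-distribˡ-* x y n)))

  +-comm : ∀ a b → a + b ≡ b + a
  +-comm a b = cong (_mod n) (ℕₚ.+-comm (toℕ a) (toℕ b))

  *-comm : ∀ a b → a * b ≡ b * a
  *-comm a b = cong (_mod n) (ℕₚ.*-comm (toℕ a) (toℕ b))

  open ≡-Reasoning

  +-assoc : ∀ a b c → (a + b) + c ≡ a + (b + c)
  +-assoc a b c = begin
    (a + b) + c                                ≡⟨ cong ((a + b) +_) (mod-toℕ c) ⟨
    (a + b) + toℕ c mod n                      ≡⟨ mod-+ _ _ ⟩
    (toℕ a ℕ.+ toℕ b ℕ.+ toℕ c) mod n          ≡⟨ cong (_mod n) (ℕₚ.+-assoc (toℕ a) _ _) ⟩
    (toℕ a ℕ.+ (toℕ b ℕ.+ toℕ c)) mod n        ≡⟨ mod-+ _ _ ⟨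
    toℕ a mod n + (b + c)                      ≡⟨ cong (_+ (b + c)) (mod-toℕ a) ⟩
    a + (b + c)                                ∎

  *-assoc : ∀ a b c → (a * b) * c ≡ a * (b * c)
  *-assoc a b c = begin
    (a * b) * c                                ≡⟨ cong ((a * b) *_) (mod-toℕ c) ⟨
    (a * b) * (toℕ c mod n)                    ≡⟨ mod-* _ _ ⟩
    (toℕ a ℕ.* toℕ b ℕ.* toℕ c) mod n          ≡⟨ cong (_mod n) (ℕₚ.*-assoc (toℕ a) _ _) ⟩
    (toℕ a ℕ.* (toℕ b ℕ.* toℕ c)) mod n        ≡⟨ mod-* _ _ ⟨
    (toℕ a mod n) * (b * c)                    ≡⟨ cong (_* (b * c)) (mod-toℕ a) ⟩
    a * (b * c)                                ∎

  *-distribˡ-+ : ∀ a b c → a * (b + c) ≡ a * b + a * c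
  *-distribˡ-+ a b c = begin
    a * (b + c)                                    ≡⟨ cong (_* (b + c)) (mod-toℕ a) ⟨
    (toℕ a mod n) * (b + c)                        ≡⟨ mod-* _ _ ⟩
    (toℕ a ℕ.* (toℕ b ℕ.+ toℕ c)) mod n            ≡⟨ cong (_mod n) (ℕₚ.*-distribˡ-+ (toℕ a) _ _) ⟩
    (toℕ a ℕ.* toℕ b ℕ.+ toℕ a ℕ.* toℕ c) mod n    ≡⟨ mod-+ _ _ ⟨
    a * b + a * c                                  ∎

  +-identityˡ : ∀ a → 0# + a ≡ a
  +-identityˡ a = begin
    0# + a             ≡⟨ cong (0# +_) (mod-toℕ a) ⟨
    0# + toℕ a mod n   ≡⟨ mod-+ 0 _ ⟩
    toℕ a mod n        ≡⟨ mod-toℕ a ⟩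
    a                  ∎

  *-identityˡ : ∀ a → 1# * a ≡ a
  *-identityˡ a = begin
    1# * a              ≡⟨ cong (1# *_) (mod-toℕ a) ⟨
    1# * (toℕ a mod n)  ≡⟨ mod-* 1 _ ⟩
    (1 ℕ.* toℕ a) mod n ≡⟨ cong (_mod n) (ℕₚ.*-identityˡ (toℕ a)) ⟩
    toℕ a mod n         ≡⟨ mod-toℕ a ⟩
    a                   ∎

  -‿inverseˡ : ∀ a → - a + a ≡ 0#
  -‿inverseˡ a = begin
    - a + a                       ≡⟨ cong (- a +_) (mod-toℕ a) ⟨
    - a + toℕ a mod n             ≡⟨ mod-+ _ _ ⟩
    (n ∸ toℕ a ℕ.+ toℕ a) mod n   ≡⟨ cong (_mod n) (ℕₚ.m∸n+n≡m (toℕ≤n a)) ⟩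
    n mod n                       ≡⟨ mod-cong ([m+n]%n≡m%n 0 n) ⟩
    0#                            ∎

  isCommutativeRing : IsCommutativeRing _≡_ _+_ _*_ -_ 0# 1#
  isCommutativeRing = record
    { isRing = record
      { +-isAbelianGroup = record
        { isGroup = record
          { isMonoid = record
            { isSemigroup = record
              { isMagma = record { isEquivalence = isEquivalence ; ∙-cong = cong₂ _+_ }
              ; assoc = +-assoc
              }
            ; identity = comm∧idˡ⇒id +-comm +-identityˡ
            }
          ; inverse = comm∧invˡ⇒inv +-comm -‿inverseˡ
          ; ⁻¹-cong = cong -_
          }
        ; comm = +-comm
        }
      ; *-cong = cong₂ _*_
      ; *-assoc = *-assoc
      ; *-identity = comm∧idˡ⇒id *-comm *-identityˡ
      ; distrib = *-distribˡ-+ , comm∧distrˡ⇒distrʳ *-comm *-distribˡ-+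
      }
    ; *-comm = *-comm
    }

ℤ/ : (n : ℕ) .{{_ : NonZero n}} → CommutativeRing 0ℓ 0ℓ
ℤ/ n = record { isCommutativeRing = Mod.isCommutativeRing n }

module _ (n : ℕ) .{{_ : NonZero n}} where

  open CommutativeRing (ℤ/ n)
    using (Carrier; _≈_; _+_; _*_; -_; _-_; 1#; ring)

  Unit : Carrier → Set
  Unit = Invertible _≈_ 1# _*_

  T : Carrier → Set
  T t = ∃[ u ] (Unit u × (t ≈ u * u ⊎ t ≈ - (u * u)))

  private
    open RingProperties ring using (-‿involutive; ⁻¹-anti-homo‿-)

    T-neg : ∀ {t} → T t → T (- t)
    T-neg (u , unit , inj₁ t≈u²)  = u , unit , inj₂ (cong -_ t≈u²)
    T-neg (u , unit , inj₂ t≈-u²) =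
      u , unit , inj₁ (trans (cong -_ t≈-u²) (-‿involutive (u * u)))

  G : Graph
  G = record
    { Vertex = Carrier
    ; _~_    = λ a b → T (a - b)
    ; ~-sym  = λ {a} {b} t → subst T (⁻¹-anti-homo‿- a b) (T-neg t)
    }

primeFactors : ℕ → List ℕ
primeFactors n = filter (λ p → prime? p ×-dec p ∣? n) (upTo (suc n))

ω : ℕ → ℕ
ω n = length (primeFactors n)

indicator : {P : Set} → Dec P → ℕ
indicator P? = if does P? then 1 else 0

γ₃ γ₅ δ₃ : ℕ → ℕ
γ₃ n = indicator (3 ∣? n)
γ₅ n = indicator (5 ∣? n)
δ₃ n = indicator (any? (λ p → 3 <? p ×-dec p % 4 ≟ 3) (primeFactors n))

module Submission where

-- A walk of length k from a to b in G n is a representation of a − b as Σ σᵢ uᵢ² with signs σᵢ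
-- and units uᵢ. For odd n and a fixed nonempty list σ of signs, such a representation exists modulo
-- n as soon as it exists modulo every prime divisor of n: all but the last unit come from the Chinese
-- remainder theorem, the last one from Newton's iteration. The theorem is thereby reduced to
-- prime moduli p:
--   * modulo 3 every unit square is 1, so that σ represents exactly Σ σᵢ;
--   * modulo 5 the signed unit squares are ±1, whatever the sign;
--   * for p > 5 every residue is u² − v²;
--   * −1 is a square modulo p if p ≡ 1 (mod 4), in which case the signs do not matter, and it
--     is not one if p ≡ 3 (mod 4), in which case 0 is not ± (u² + v²).
-- The diameter exceeds 2 exactly when these conditions on σ conflict: at 3 (x ≡ 1 needs the
-- signs −, −) with a prime p ≡ 3 (mod 4) (x ≡ 0 needs opposite signs), and at 5
-- (x ≡ ±1 needs length 1 or at least 3) with any other prime divisor (x ≡ 0 excludes length 1).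

-- Congruences of integers and signed sums of unit squares.

module Congruence where

  open import Data.Empty using (⊥-elim)
  open import Data.Integer.Base
    using (ℤ; +_; -[1+_]; 0ℤ; 1ℤ; -1ℤ; _+_; _*_; _-_; -_) renaming (∣_∣ to abs)
  open import Data.Integer.Divisibility.Signed
    using (_∣_; divides; ∣ᵤ⇒∣; ∣⇒∣ᵤ; ∣-trans; ∣m∣n⇒∣m+n; ∣n⇒∣m*n; ∣m⇒∣m*n)
  open import Data.Integer.Properties using (pos-*; abs-*; *-comm)
  open import Data.Integer.Tactic.RingSolver using (solve; solve-∀)
  open import Data.List.Base using (List; []; _∷_)
  open import Data.List.Membership.Propositional using (_∈_)
  open import Data.List.Relation.Unary.All as All using (All)
  open import Data.List.Relation.Unary.Any using (here; there)
  import Data.Nat as ℕ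
  open import Data.Nat using (ℕ)
  import Data.Nat.Divisibility as ℕ
  open import Data.Nat.GCD using (module Bézout)
  open import Data.Nat.ListAction using (product)
  open import Data.Nat.Coprimality using (Coprime; coprime-Bézout)
  open import Data.Nat.Primality
    using (Prime; euclidsLemma; prime⇒irreducible; irreducible[2]; ¬prime[1])
  open import Data.Nat.Primality.Factorisation
    using (PrimeFactorisation; factorise; factorisationHasAllPrimeFactors)
  open import Data.List.Membership.DecPropositional ℕ._≟_ using (_∈?_)
  open import Data.Product using (_×_; _,_; ∃; ∃-syntax; proj₁; proj₂)
  import Data.Sign as Sign
  open import Data.Sign using (Sign)
  open import Data.Sum using (_⊎_; inj₁; inj₂)
  open import Relation.Binary.PropositionalEquality
  open import Relation.Nullary using (¬_; yes; no)

  infix 4 _≈_mod_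

  _≈_mod_ : ℤ → ℤ → ℤ → Set
  a ≈ b mod d = d ∣ a - b

  ∣-resp : ∀ {d a b} → d ∣ a → a ≡ b → d ∣ b
  ∣-resp d∣a refl = d∣a

  ∣-multiple : ∀ {d a b} k → d ∣ a → b ≡ k * a → d ∣ b
  ∣-multiple k d∣a eq = ∣-resp (∣n⇒∣m*n k d∣a) (sym eq)

  ∣-combination : ∀ {d a b c} k l → d ∣ a → d ∣ b → c ≡ k * a + l * b → d ∣ c
  ∣-combination k l d∣a d∣b eq = ∣-resp (∣m∣n⇒∣m+n (∣n⇒∣m*n k d∣a) (∣n⇒∣m*n l d∣b)) (sym eq)

  ≈-sym : ∀ {d} a b → a ≈ b mod d → b ≈ a mod d
  ≈-sym a b a≈b = ∣-multiple -1ℤ a≈b (solve (a ∷ b ∷ []))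

  ≈-trans : ∀ {d} a b c → a ≈ b mod d → b ≈ c mod d → a ≈ c mod d
  ≈-trans a b c a≈b b≈c = ∣-combination 1ℤ 1ℤ a≈b b≈c (solve (a ∷ b ∷ c ∷ []))

  ∣-≈ : ∀ {d} a b → d ∣ a → a ≈ b mod d → d ∣ b
  ∣-≈ a b d∣a a≈b = ∣-combination 1ℤ -1ℤ d∣a a≈b (solve (a ∷ b ∷ []))

  ∣⇒≈0 : ∀ {d} a → d ∣ a → a ≈ 0ℤ mod d
  ∣⇒≈0 a d∣a = ∣-multiple 1ℤ d∣a (solve (a ∷ []))

  ≈0⇒∣ : ∀ {d} a → a ≈ 0ℤ mod d → d ∣ a
  ≈0⇒∣ a a≈0 = ∣-multiple 1ℤ a≈0 (solve (a ∷ []))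

  record IsUnit (d a : ℤ) : Set where
    constructor unit
    field
      inverse   : ℤ
      isInverse : a * inverse ≈ 1ℤ mod d

  unit-1 : ∀ d → IsUnit d 1ℤ
  unit-1 d = unit 1ℤ (divides 0ℤ refl)

  unit-* : ∀ {d a b} → IsUnit d a → IsUnit d b → IsUnit d (a * b)
  unit-* {a = a} {b} (unit a′ aa′≈1) (unit b′ bb′≈1) =
    unit (a′ * b′) (∣-combination (b * b′) 1ℤ aa′≈1 bb′≈1 (solve (a ∷ b ∷ a′ ∷ b′ ∷ [])))

  unit-neg : ∀ {d a} → IsUnit d a → IsUnit d (- a)
  unit-neg {a = a} (unit a′ aa′≈1) = unit (- a′) (∣-multiple 1ℤ aa′≈1 (solve (a ∷ a′ ∷ [])))

  unit-inverse : ∀ {d a} (u : IsUnit d a) → IsUnit d (IsUnit.inverse u)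
  unit-inverse {a = a} (unit a′ aa′≈1) = unit a (∣-multiple 1ℤ aa′≈1 (solve (a ∷ a′ ∷ [])))

  unit-factorˡ : ∀ {d} a b → IsUnit d (a * b) → IsUnit d a
  unit-factorˡ a b (unit c abc≈1) = unit (b * c) (∣-multiple 1ℤ abc≈1 (solve (a ∷ b ∷ c ∷ [])))

  unit-cong : ∀ {d} a b → a ≈ b mod d → IsUnit d a → IsUnit d b
  unit-cong a b a≈b (unit c ac≈1) = unit c (∣-combination 1ℤ (- c) ac≈1 a≈b (solve (a ∷ b ∷ c ∷ [])))

  unit-∣ : ∀ {d e a} → e ∣ d → IsUnit d a → IsUnit e a
  unit-∣ e∣d (unit b ab≈1) = unit b (∣-trans e∣d ab≈1)

  sgn : Sign → ℤ
  sgn Sign.+ = 1ℤ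
  sgn Sign.- = -1ℤ

  -- x ≡ Σᵢ σᵢ uᵢ² modulo d for some units uᵢ.
  data Rep (d : ℤ) : List Sign → ℤ → Set where
    done : ∀ {x} → d ∣ x → Rep d [] x
    term : ∀ {s σ x} u → IsUnit d u → Rep d σ (x - sgn s * (u * u)) → Rep d (s ∷ σ) x

  Rep-cong : ∀ {d σ} x y → x ≈ y mod d → Rep d σ x → Rep d σ y
  Rep-cong x y x≈y (done r) = done (∣-≈ x y r x≈y)
  Rep-cong x y x≈y (term {s} u unit-u r) =
    term u unit-u (Rep-cong _ _ (∣-multiple 1ℤ x≈y (eq x y (sgn s) u)) r)
    where
    eq : ∀ x y s u → (x - s * (u * u)) - (y - s * (u * u)) ≡ 1ℤ * (x - y)
    eq = solve-∀

  Rep-∣ : ∀ {d e σ x} → e ∣ d → Rep d σ x → Rep e σ x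
  Rep-∣ e∣d (done r)          = done (∣-trans e∣d r)
  Rep-∣ e∣d (term u unit-u r) = term u (unit-∣ e∣d unit-u) (Rep-∣ e∣d r)

  -- Fixes both integers as nonnegative, since their signs cannot be inferred from their absolute
  -- values.
  ∣ᵤ⇒∣⁺ : ∀ {m n} → m ℕ.∣ n → + m ∣ + n
  ∣ᵤ⇒∣⁺ = ∣ᵤ⇒∣

  abstract
    euclid : ∀ {p} → Prime p → ∀ a b → + p ∣ a * b → + p ∣ a ⊎ + p ∣ b
    euclid {p} pp a b p∣ab with euclidsLemma (abs a) (abs b) pp (subst (p ℕ.∣_) (abs-* a b) (∣⇒∣ᵤ p∣ab))
    ... | inj₁ p∣a = inj₁ (∣ᵤ⇒∣ p∣a)
    ... | inj₂ p∣b = inj₂ (∣ᵤ⇒∣ p∣b)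

  -- Bézout's identity over the naturals comes in two forms, according to which multiple is the
  -- larger one. The coefficient of `abs a` is the inverse in the first and the negative of the
  -- inverse in the second.
  coprime⇒unit : ∀ {m} a → Coprime (abs a) m → IsUnit (+ m) (+ abs a)
  coprime⇒unit {m} a c with coprime-Bézout c
  ... | Bézout.+- x y eq = unit (+ x) (divides (+ y) (begin
    + n * + x - 1ℤ               ≡⟨ cong (_- 1ℤ) (*-comm (+ n) (+ x)) ⟩
    + x * + n - 1ℤ               ≡⟨ cong (_- 1ℤ) (pos-* x n) ⟨
    + (x ℕ.* n) - 1ℤ             ≡⟨ cong (λ k → + k - 1ℤ) eq ⟨
    1ℤ + + (y ℕ.* m) - 1ℤ        ≡⟨ cong (λ k → 1ℤ + k - 1ℤ) (pos-* y m) ⟩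
    1ℤ + + y * + m - 1ℤ          ≡⟨ cancel (+ y * + m) ⟩
    + y * + m                    ∎))
    where
    open ≡-Reasoning
    n = abs a
    cancel : ∀ k → 1ℤ + k - 1ℤ ≡ k
    cancel = solve-∀
  ... | Bézout.-+ x y eq = unit (- (+ x)) (divides (- (+ y)) (begin
    + n * - (+ x) - 1ℤ           ≡⟨ move (+ n) (+ x) ⟩
    - (1ℤ + + x * + n)           ≡⟨ cong (λ k → - (1ℤ + k)) (pos-* x n) ⟨
    - (+ (1 ℕ.+ x ℕ.* n))        ≡⟨ cong (λ k → - (+ k)) eq ⟩
    - (+ (y ℕ.* m))              ≡⟨ cong -_ (pos-* y m) ⟩
    - (+ y * + m)                ≡⟨ neg (+ y) (+ m) ⟩
    - (+ y) * + m                ∎))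
    where
    open ≡-Reasoning
    n = abs a
    move : ∀ n x → n * - x - 1ℤ ≡ - (1ℤ + x * n)
    move = solve-∀
    neg : ∀ y m → - (y * m) ≡ - y * m
    neg = solve-∀

  abstract
    prime∤⇒unit : ∀ {p} → Prime p → ∀ a → ¬ (+ p ∣ a) → IsUnit (+ p) a
    prime∤⇒unit {p} pp a p∤a = fix a (coprime⇒unit a coprime)
      where
      coprime : Coprime (abs a) p
      coprime (d∣a , d∣p) with prime⇒irreducible pp d∣p
      ... | inj₁ d≡1  = d≡1
      ... | inj₂ refl = ⊥-elim (p∤a (∣ᵤ⇒∣ d∣a))
      fix : ∀ a → IsUnit (+ p) (+ abs a) → IsUnit (+ p) a
      fix (+ n)        u = u
      fix (-[1+ n ]) u = unit-neg u

  unit⇒prime∤ : ∀ {p a} → Prime p → IsUnit (+ p) a → ¬ (+ p ∣ a)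
  unit⇒prime∤ {p} {a} pp (unit b ab≈1) p∣a = contra pp (ℕ.∣1⇒≡1 (∣⇒∣ᵤ p∣1))
    where
    p∣1 : + p ∣ 1ℤ
    p∣1 = ∣-combination b -1ℤ p∣a ab≈1 (solve (a ∷ b ∷ []))
    contra : ∀ {q} → Prime q → ¬ (q ≡ 1)
    contra q refl = ¬prime[1] q

  -- Products of primes, the Chinese remainder theorem and lifting of square roots.

  ∈⇒∣product : ∀ {p} ps → p ∈ ps → + p ∣ + product ps
  ∈⇒∣product (p ∷ ps) (here refl) = ∣ᵤ⇒∣⁺ (ℕ.m∣m*n (product ps))
  ∈⇒∣product (q ∷ ps) (there p∈ps) = ∣-trans (∈⇒∣product ps p∈ps) (∣ᵤ⇒∣⁺ (ℕ.n∣m*n q))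

  *-∣-* : ∀ {c d a b} → c ∣ a → d ∣ b → c * d ∣ a * b
  *-∣-* {c} {d} (divides q refl) (divides r refl) = divides (q * r) (solve (c ∷ d ∷ q ∷ r ∷ []))

  product-∣ : ∀ q ps {a b} → + q ∣ a → + product ps ∣ b → + product (q ∷ ps) ∣ a * b
  product-∣ q ps q∣a ps∣b = subst (_∣ _) (sym (pos-* q (product ps))) (*-∣-* q∣a ps∣b)

  -- If `b` inverts `a` modulo `q` and `c` inverts `a` modulo the remaining product, then 1 - (1 -
  -- ab)(1 - ac) is a multiple of `a` that is 1 modulo the whole product. Repeated entries of the
  -- list are covered.
  unit-product : ∀ ps a → (∀ {p} → p ∈ ps → IsUnit (+ p) a) → IsUnit (+ product ps) a
  unit-product []       a local = unit 0ℤ (divides (a * 0ℤ - 1ℤ) (solve (a ∷ [])))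
  unit-product (q ∷ ps) a local with local (here refl) | unit-product ps a (λ p∈ps → local (there p∈ps))
  ... | unit b ab≈1 | unit c ac≈1 =
    unit (b + c - a * (b * c)) (∣-multiple -1ℤ (product-∣ q ps ab≈1 ac≈1) (eq a b c))
    where
    eq : ∀ a b c → a * (b + c - a * (b * c)) - 1ℤ ≡ -1ℤ * ((a * b - 1ℤ) * (a * c - 1ℤ))
    eq = solve-∀

  prime∤product : ∀ {p} → Prime p → ∀ ps → All Prime ps → ¬ (p ∈ ps) → ¬ (+ p ∣ + product ps)
  prime∤product pp ps primes p∉ps p∣ps =
    p∉ps (factorisationHasAllPrimeFactors pp (∣⇒∣ᵤ p∣ps) primes)

  -- A property `P` that respects congruence takes the place of prescribed residues, so that the
  -- integer is chosen together with what has to hold for it at each prime. A prime that occurs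
  -- again in the tail is served by the tail.
  chineseRemainder : ∀ ps → All Prime ps → (P : ℕ → ℤ → Set) →
    (∀ {p} a b → a ≈ b mod + p → P p a → P p b) →
    (∀ {p} → p ∈ ps → ∃ (P p)) → ∃[ a ] (∀ {p} → p ∈ ps → P p a)
  chineseRemainder []       All.[]       P resp local = 0ℤ , λ ()
  chineseRemainder (q ∷ ps) (qp All.∷ primes) P resp local
    with chineseRemainder ps primes P resp (λ p∈ps → local (there p∈ps)) | q ∈? ps
  ... | a , Pa | yes q∈ps = a , λ { (here refl) → Pa q∈ps ; (there p∈ps) → Pa p∈ps }
  ... | a , Pa | no  q∉ps
    with local (here refl) | prime∤⇒unit qp (+ product ps) (prime∤product qp ps primes q∉ps)
  -- `M * k` is 0 modulo the primes of `ps` and 1 modulo `q`, so the witness is `a` at the former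
  -- and `b` at the latter.
  ...   | b , Pb | unit k Mk≈1 = a + M * k * (b - a) , λ
    { (here refl)  → resp b _ (∣-multiple (a - b) Mk≈1 (eq₁ a b M k)) Pb
    ; (there p∈ps) → resp a _ (∣-multiple (k * (a - b)) (∈⇒∣product ps p∈ps) (eq₂ a b M k)) (Pa p∈ps)
    }
    where
    M = + product ps
    eq₁ : ∀ a b M k → b - (a + M * k * (b - a)) ≡ (a - b) * (M * k - 1ℤ)
    eq₁ = solve-∀
    eq₂ : ∀ a b M k → a - (a + M * k * (b - a)) ≡ k * (a - b) * M
    eq₂ = solve-∀

  -- Newton's iteration u ↦ u − (u² − c) / 2u squares the error u² − c, so that
  -- every step gains a prime factor.
  liftSquareRoot : ∀ d c → IsUnit d (+ 2) → ∀ ps → + product ps ∣ d →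
    ∃[ u ] (IsUnit d u × (∀ {p} → p ∈ ps → + p ∣ u * u - c)) →
    (∀ {u} → (∀ {p} → p ∈ ps → + p ∣ u * u - c) → IsUnit d u) →
    ∃[ u ] (IsUnit d u × + product ps ∣ u * u - c)
  liftSquareRoot d c (unit h 2h≈1) ps₀ ps₀∣d (u₀ , unit₀ , close₀) closeUnit =
    let u , unit-u , _ , ps∣ = lift ps₀ (λ p∈ → p∈) ps₀∣d in u , unit-u , ps∣
    where
    newton : ∀ u v → u * v ≈ 1ℤ mod d →
      (let u′ = u - (u * u - c) * (v * h)) →
      u′ * u′ - c ≈ (u * u - c) * (u * u - c) * ((v * h) * (v * h)) mod d
    newton u v uv≈1 = ∣-combination (- ((u * u - c) * (u * v))) (- (u * u - c)) 2h≈1 uv≈1 (eq u v c h)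
      where
      eq : ∀ u v c h → (let u′ = u - (u * u - c) * (v * h)) →
        (u′ * u′ - c) - (u * u - c) * (u * u - c) * ((v * h) * (v * h)) ≡
        (- ((u * u - c) * (u * v))) * (+ 2 * h - 1ℤ) + (- (u * u - c)) * (u * v - 1ℤ)
      eq = solve-∀

    -- The invariant keeps `u` a root modulo every prime of the whole list `ps₀`, not only of the
    -- part treated so far. Thus the error is divisible by `q` and by `product ps`, and its square
    -- by their product.
    lift : ∀ ps → (∀ {p} → p ∈ ps → p ∈ ps₀) → + product ps ∣ d →
      ∃[ u ] (IsUnit d u × (∀ {p} → p ∈ ps₀ → + p ∣ u * u - c) × + product ps ∣ u * u - c)
    lift []       ps⊆ ps∣d = u₀ , unit₀ , close₀ , divides (u₀ * u₀ - c) (one (u₀ * u₀ - c))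
      where
      one : ∀ a → a ≡ a * 1ℤ
      one = solve-∀
    lift (q ∷ ps) ps⊆ qps∣d
      with lift ps (λ p∈ → ps⊆ (there p∈)) (∣-trans (∣ᵤ⇒∣⁺ (ℕ.n∣m*n q)) qps∣d)
    ... | u , unit v uv≈1 , close , ps∣ =
      u′ , closeUnit close′ , close′ , step (product-∣ q ps (close (ps⊆ (here refl))) ps∣) qps∣d
      where
      u′ = u - (u * u - c) * (v * h)
      e  = u * u - c
      step : ∀ {k} → k ∣ e * e → k ∣ d → k ∣ u′ * u′ - c
      step k∣ k∣d = ∣-≈ (e * e * ((v * h) * (v * h))) (u′ * u′ - c) (∣m⇒∣m*n _ k∣)
        (≈-sym (u′ * u′ - c) (e * e * ((v * h) * (v * h))) (∣-trans k∣d (newton u v uv≈1)))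
      close′ : ∀ {p} → p ∈ ps₀ → + p ∣ u′ * u′ - c
      close′ p∈ = step (∣m⇒∣m*n e (close p∈)) (∣-trans (∈⇒∣product ps₀ p∈) ps₀∣d)

  sgn² : ∀ s → sgn s * sgn s ≡ 1ℤ
  sgn² Sign.+ = refl
  sgn² Sign.- = refl

  -- Passage from the prime divisors of `n` to `n` itself.

  module _ (n : ℕ) .{{_ : ℕ.NonZero n}} (odd : ¬ (2 ℕ.∣ n)) where
    private
      open PrimeFactorisation (factorise n)

      ∈factors⇒∣ : ∀ {p} → p ∈ factors → p ℕ.∣ n
      ∈factors⇒∣ {p} p∈ = subst (p ℕ.∣_) (sym isFactorisation) (∣⇒∣ᵤ (∈⇒∣product factors p∈))

      ∈factors⇒prime : ∀ {p} → p ∈ factors → Prime p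
      ∈factors⇒prime = All.lookup factorsPrime

      ∈factors⇒∣⁺ : ∀ {p} → p ∈ factors → + p ∣ + n
      ∈factors⇒∣⁺ p∈ = ∣ᵤ⇒∣⁺ (∈factors⇒∣ p∈)

    localUnit : ∀ a → (∀ p → Prime p → p ℕ.∣ n → IsUnit (+ p) a) → IsUnit (+ n) a
    localUnit a local = subst (λ m → IsUnit (+ m) a) (sym isFactorisation)
      (unit-product factors a λ p∈ → local _ (∈factors⇒prime p∈) (∈factors⇒∣ p∈))

    unit-2 : IsUnit (+ n) (+ 2)
    unit-2 = localUnit (+ 2) λ p pp p∣n → prime∤⇒unit pp (+ 2) λ p∣2 → contra p pp p∣n (∣⇒∣ᵤ p∣2)
      where
      contra : ∀ p → Prime p → p ℕ.∣ n → ¬ (p ℕ.∣ 2)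
      contra p pp p∣n p∣2 with irreducible[2] p∣2
      ... | inj₁ refl = ¬prime[1] pp
      ... | inj₂ refl = odd p∣n

    -- Roots at the primes are glued by the Chinese remainder theorem and then lifted. An integer
    -- that is a root at every prime factor is a unit modulo `n`, because its square is congruent
    -- there to the unit `c`; so Newton's iteration can divide by it at every step.
    localSquare : ∀ c → IsUnit (+ n) c →
      (∀ p → Prime p → p ℕ.∣ n → ∃[ u ] (+ p ∣ u * u - c)) →
      ∃[ u ] (IsUnit (+ n) u × + n ∣ u * u - c)
    localSquare c unitc local =
      let
        u , close = chineseRemainder factors factorsPrime (λ p u → + p ∣ u * u - c)
          (λ {p} a b a≈b a²≈c → ∣-combination 1ℤ (- (a + b)) a²≈c a≈b (solve (a ∷ b ∷ c ∷ [])))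
          (λ p∈ → local _ (∈factors⇒prime p∈) (∈factors⇒∣ p∈))
        v , unit-v , n∣ = liftSquareRoot (+ n) c unit-2 factors
          (subst (λ m → + m ∣ + n) isFactorisation (∣ᵤ⇒∣⁺ ℕ.∣-refl))
          (u , closeUnit u close , close) (closeUnit _)
      in v , unit-v , subst (λ m → + m ∣ v * v - c) (sym isFactorisation) n∣
      where
      closeUnit : ∀ u → (∀ {p} → p ∈ factors → + p ∣ u * u - c) → IsUnit (+ n) u
      closeUnit u close = subst (λ m → IsUnit (+ m) u) (sym isFactorisation)
        (unit-product factors u λ p∈ → unit-factorˡ u u
          (unit-cong c (u * u) (≈-sym (u * u) c (close p∈)) (unit-∣ (∈factors⇒∣⁺ p∈) unitc)))

    -- The list is nonempty by its form, because divisibility of `x` by every prime factor of `n`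
    -- does not give divisibility by `n`. For a longer list, the property handed to the Chinese
    -- remainder theorem includes that the rest of `x` is representable by the tail at each prime,
    -- as the recursion demands.
    localRep : ∀ s σ x → (∀ p → Prime p → p ℕ.∣ n → Rep (+ p) (s ∷ σ) x) → Rep (+ n) (s ∷ σ) x
    -- As s² = 1, the congruence x ≡ s u² is solved in the form u² ≡ s x.
    localRep s [] x local =
      let u , unit-u , u²≈ = localSquare (sgn s * x)
            (localUnit _ λ p pp p∣n → square-unit (local p pp p∣n))
            (λ p pp p∣n → square-root (local p pp p∣n))
      in term u unit-u (done (back u u²≈))
      where
      S = sgn s
      S²* : ∀ a → a ≡ S * S * a
      S²* a = trans (one a) (cong (_* a) (sym (sgn² s)))
        where
        one : ∀ a → a ≡ 1ℤ * a
        one = solve-∀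
      square : ∀ {d} v → d ∣ x - S * (v * v) → d ∣ S * x - v * v
      square v x≈ = ∣-multiple S x≈ (trans (cong (λ k → S * x - k) (S²* (v * v))) (eq S x v))
        where
        eq : ∀ s x v → s * x - s * s * (v * v) ≡ s * (x - s * (v * v))
        eq = solve-∀
      square-unit : ∀ {d} → Rep d (s ∷ []) x → IsUnit d (S * x)
      square-unit (term v unit-v (done x≈)) =
        unit-cong (v * v) (S * x) (≈-sym (S * x) (v * v) (square v x≈)) (unit-* unit-v unit-v)
      square-root : ∀ {d} → Rep d (s ∷ []) x → ∃[ u ] (d ∣ u * u - S * x)
      square-root (term v unit-v (done x≈)) = v , ≈-sym (S * x) (v * v) (square v x≈)
      back : ∀ {d} u → d ∣ u * u - S * x → d ∣ x - S * (u * u)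
      back u u²≈ = ∣-multiple (- S) u²≈ (trans (cong (_- S * (u * u)) (S²* x)) (eq S x u))
        where
        eq : ∀ s x u → s * s * x - s * (u * u) ≡ - s * (u * u - s * x)
        eq = solve-∀
    localRep s (t ∷ σ) x local =
      let
        u , good = chineseRemainder factors factorsPrime
          (λ p u → IsUnit (+ p) u × Rep (+ p) (t ∷ σ) (x - sgn s * (u * u)))
          (λ {p} a b a≈b (unit-a , r) → unit-cong a b a≈b unit-a ,
             Rep-cong (x - sgn s * (a * a)) (x - sgn s * (b * b))
               (∣-multiple (- (sgn s * (a + b))) a≈b (eq x (sgn s) a b)) r)
          (λ p∈ → uncons (local _ (∈factors⇒prime p∈) (∈factors⇒∣ p∈)))
        ∈factors : ∀ {p} → Prime p → p ℕ.∣ n → p ∈ factors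
        ∈factors {p} pp p∣n =
          factorisationHasAllPrimeFactors pp (subst (p ℕ.∣_) isFactorisation p∣n) factorsPrime
      in term u (localUnit u (λ p pp p∣n → proj₁ (good (∈factors pp p∣n))))
           (localRep t σ (x - sgn s * (u * u)) (λ p pp p∣n → proj₂ (good (∈factors pp p∣n))))
      where
      eq : ∀ x s a b → (x - s * (a * a)) - (x - s * (b * b)) ≡ - (s * (a + b)) * (a - b)
      eq = solve-∀
      uncons : ∀ {d} → Rep d (s ∷ t ∷ σ) x → ∃[ u ] (IsUnit d u × Rep d (t ∷ σ) (x - sgn s * (u * u)))
      uncons (term u unit-u r) = u , unit-u , r

-- Square roots modulo an odd prime by counting.

module QuadraticResidues where

  open Congruence
  open import Data.Empty using (⊥-elim)
  open import Data.Fin.Base using (Fin; toℕ; fromℕ<)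
  import Data.Fin.Properties as Fin
  open import Data.Integer.Base using (ℤ; +_; 0ℤ; 1ℤ; -1ℤ; _+_; _*_; _-_; -_) renaming (∣_∣ to abs)
  open import Data.Integer.DivMod using (_%ℕ_; _/ℕ_; n%ℕd<d; a≡a%ℕn+[a/ℕn]*n)
  open import Data.Integer.Divisibility.Signed using (_∣_; _∣?_; divides; ∣-refl; ∣⇒∣ᵤ)
  open import Data.Integer.Properties
    using (pos-+; *-comm; ∣m⊝n∣≤m⊔n; i-j≡0⇒i≡j; +-injective; ∣i∣≡0⇒i≡0; ⊖-≥; m-n≡m⊖n)
  open import Data.Integer.Tactic.RingSolver using (solve-∀)
  open import Data.List.Base using (List; _∷_; length; applyUpTo)
  open import Data.List.Membership.Propositional using (_∈_)
  open import Data.List.Membership.Propositional.Properties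
    using (∈-∃++; ∈-applyUpTo⁺; ∈-applyUpTo⁻)
  open import Data.List.Properties using (length-applyUpTo)
  open import Data.List.Relation.Binary.Permutation.Propositional using (_↭_; ↭⇒↭ₛ; prep; ↭-sym)
  open import Data.List.Relation.Binary.Permutation.Propositional.Properties
    using (shift; ↭-length; ∈-resp-↭)
  open import Data.List.Relation.Binary.Permutation.Setoid.Properties using (Unique-resp-↭)
  open import Data.List.Relation.Unary.All as All using (All)
  open import Data.List.Relation.Unary.AllPairs as AllPairs using ()
  open import Data.List.Relation.Unary.Any using (here; there)
  open import Data.List.Relation.Unary.Unique.Propositional using (Unique)
  open import Data.List.Relation.Unary.Unique.Propositional.Properties using (applyUpTo⁺₁)
  import Data.Nat as ℕ
  open import Data.Nat using (ℕ; suc; zero)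
  import Data.Nat.Properties as ℕ
  import Data.Nat.Divisibility as ℕ
  open import Data.Nat.Primality using (Prime)
  open import Data.Product using (_×_; _,_; ∃; ∃-syntax; proj₁; proj₂)
  open import Data.Sum using (_⊎_; inj₁; inj₂)
  open import Relation.Binary.PropositionalEquality
  open import Relation.Nullary using (¬_; yes; no; Dec)

  ∈-↭ : ∀ {A : Set} {x : A} {xs} → x ∈ xs → ∃[ ys ] (xs ↭ x ∷ ys)
  ∈-↭ {x = x} x∈xs with ∈-∃++ x∈xs
  ... | as , bs , refl = _ , shift x as bs

  -- An involution is given by its graph, so that `R` stays the same when a pair is deleted from the
  -- list. Partners are unique only within `xs`, since modulo a prime a quotient is unique only
  -- within a system of representatives.
  record PartialPairing {A : Set} (R : A → A → Set) (xs : List A) : Set where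
    field
      symmetric  : ∀ {x y} → R x y → R y x
      partner    : ∀ {x} → x ∈ xs → ∃[ y ] (y ∈ xs × R x y)
      functional : ∀ {x y z} → x ∈ xs → y ∈ xs → z ∈ xs → R x y → R x z → y ≡ z

  -- R is the graph of an involution of xs, and removing a two-element orbit preserves the parity of
  -- the length.
  abstract
    fixedPoint : ∀ {A : Set} {R : A → A → Set} m (xs : List A) → Unique xs →
      length xs ≡ suc (m ℕ.+ m) → PartialPairing R xs → ∃[ x ] (x ∈ xs × R x x)
    fixedPoint {R = R} m (x ∷ ys) unique len pairing with PartialPairing.partner pairing (here refl)
    ... | y , here refl , Rxx = x , here refl , Rxx
    ... | y , there y∈ys , Rxy with ∈-↭ y∈ys
    ... | zs , ys↭ = descend m (trans (sym (↭-length ys↭)) (ℕ.suc-injective len))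
      where
      open PartialPairing pairing
      xs↭ : x ∷ ys ↭ x ∷ y ∷ zs
      xs↭ = prep x ys↭
      unique′ : Unique (x ∷ y ∷ zs)
      unique′ = Unique-resp-↭ (setoid _) (↭⇒↭ₛ xs↭) unique
      ⊆ : ∀ {z} → z ∈ zs → z ∈ x ∷ ys
      ⊆ z∈ = ∈-resp-↭ (↭-sym xs↭) (there (there z∈))
      x≢ : ∀ {z} → z ∈ zs → ¬ (x ≡ z)
      x≢ z∈ = All.lookup (All.tail (AllPairs.head unique′)) z∈
      y≢ : ∀ {z} → z ∈ zs → ¬ (y ≡ z)
      y≢ z∈ = All.lookup (AllPairs.head (AllPairs.tail unique′)) z∈
      pairing′ : PartialPairing R zs
      pairing′ = record
        { symmetric  = symmetric
        ; partner    = partner′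
        ; functional = λ x∈ y∈ z∈ → functional (⊆ x∈) (⊆ y∈) (⊆ z∈)
        }
        where
        partner′ : ∀ {z} → z ∈ zs → ∃[ w ] (w ∈ zs × R z w)
        partner′ z∈ with partner (⊆ z∈)
        ... | w , w∈ , Rzw with ∈-resp-↭ xs↭ w∈
        ... | here refl          =
          ⊥-elim (y≢ z∈ (functional (here refl) (there y∈ys) (⊆ z∈) Rxy (symmetric Rzw)))
        ... | there (here refl)  =
          ⊥-elim (x≢ z∈ (functional (there y∈ys) (here refl) (⊆ z∈) (symmetric Rxy) (symmetric Rzw)))
        ... | there (there w∈zs) = w , w∈zs , Rzw
      descend : ∀ m → length (y ∷ zs) ≡ m ℕ.+ m → ∃[ w ] (w ∈ x ∷ ys × R w w)
      descend (suc m) eq =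
        let z , z∈ , Rzz = fixedPoint m zs (AllPairs.tail (AllPairs.tail unique′))
              (trans (ℕ.suc-injective eq) (ℕ.+-suc m m)) pairing′
        in z , ⊆ z∈ , Rzz

  residue : ∀ n .{{_ : ℕ.NonZero n}} x → ∃[ r ] (r ℕ.< n × x ≈ + r mod + n)
  residue n x = x %ℕ n , n%ℕd<d x n ,
    divides (x /ℕ n) (trans (cong (_- + (x %ℕ n)) (a≡a%ℕn+[a/ℕn]*n x n)) (cancel (+ (x %ℕ n)) (x /ℕ n * + n)))
    where
    cancel : ∀ r q → r + q - r ≡ q
    cancel = solve-∀

  small-multiple : ∀ {p} a → + p ∣ a → abs a ℕ.< p → a ≡ 0ℤ
  small-multiple {p} a p∣a a<p = ∣i∣≡0⇒i≡0 (zero? (abs a) (∣⇒∣ᵤ p∣a) a<p)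
    where
    zero? : ∀ n → p ℕ.∣ n → n ℕ.< p → n ≡ 0
    zero? zero    _   _   = refl
    zero? (suc n) p∣n n<p = ⊥-elim (ℕ.>⇒∤ n<p p∣n)

  ≈-small : ∀ {p i j} → + i ≈ + j mod + p → i ℕ.< p → j ℕ.< p → i ≡ j
  ≈-small {p} {i} {j} i≈j i<p j<p = +-injective (i-j≡0⇒i≡j (+ i) (+ j) (small-multiple (+ i - + j) i≈j
    (subst (λ k → abs k ℕ.< p) (sym (m-n≡m⊖n i j)) (ℕ.≤-<-trans (∣m⊝n∣≤m⊔n i j) (ℕ.⊔-pres-<m i<p j<p)))))

  ∣-small : ∀ {p i} → + p ∣ + i → i ℕ.< p → i ≡ 0
  ∣-small p∣i i<p = +-injective (small-multiple _ p∣i i<p)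

  module OddPrime {h} (pp : Prime (suc (h ℕ.+ h))) where

    p = suc (h ℕ.+ h)

    -- The integers 1, ..., h represent the nonzero residues up to sign: a residue r above h is
    -- replaced by p - r. The representative is `suc z`, hence the bound `z < h`.
    halfResidue : ∀ x → ¬ (+ p ∣ x) → ∃[ z ] (z ℕ.< h × (+ p ∣ + suc z - x ⊎ + p ∣ + suc z + x))
    halfResidue x p∤x with residue p x
    ... | zero  , _     , x≈r = ⊥-elim (p∤x (≈0⇒∣ x x≈r))
    ... | suc r , r+1<p , x≈r with r ℕ.<? h
    ...   | yes r<h = r , r<h , inj₁ (≈-sym x (+ suc r) x≈r)
    ...   | no  r≮h = 
      -- The successor of this number is p - (r + 1), as p = 2h + 1.
      h ℕ.+ h ℕ.∸ suc r , z<h ,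
      inj₂ (∣-combination 1ℤ 1ℤ x≈r ∣-refl (trans (cong (λ k → k + x) eq₁) (eq (+ p) x (+ suc r))))
      where
      r<h+h : suc r ℕ.≤ h ℕ.+ h
      r<h+h = ℕ.≤-pred r+1<p
      z<h : h ℕ.+ h ℕ.∸ suc r ℕ.< h
      z<h = ℕ.+-cancelʳ-< (suc r) _ _ (subst (ℕ._< h ℕ.+ suc r) (sym (ℕ.m∸n+n≡m r<h+h))
        (ℕ.+-monoʳ-< h (ℕ.s≤s (ℕ.≮⇒≥ r≮h))))
      eq₁ : + suc (h ℕ.+ h ℕ.∸ suc r) ≡ + p - + suc r
      eq₁ = sym (trans (m-n≡m⊖n p (suc r)) (trans (⊖-≥ (ℕ.<⇒≤ r+1<p)) (cong +_ (ℕ.+-∸-assoc 1 r<h+h))))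
      eq : ∀ p x r → p - r + x ≡ 1ℤ * (x - r) + 1ℤ * p
      eq = solve-∀

    suc<p : ∀ {i} → i ℕ.< h → suc i ℕ.< p
    suc<p i<h = ℕ.s≤s (ℕ.≤-trans i<h (ℕ.m≤m+n h h))

    suc∤ : ∀ {i} → i ℕ.< h → ¬ (+ p ∣ + suc i)
    suc∤ i<h p∣ = ℕ.1+n≢0 (∣-small {p} p∣ (suc<p i<h))

    +∤ : ∀ {i j} → i ℕ.< h → j ℕ.< h → ¬ (+ p ∣ + suc i + + suc j)
    +∤ i<h j<h p∣ = ℕ.1+n≢0
      (∣-small {p} (∣-resp p∣ (sym (pos-+ (suc _) (suc _)))) (ℕ.s≤s (ℕ.+-mono-≤ i<h j<h)))

    -- For `a` prime to `p`, the class ± a / y has exactly one representative among 1, ..., h. The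
    -- relation is therefore the graph of an involution there, and its fixed points are square roots
    -- of ± a.
    data PlusMinusQuotient (a : ℤ) (y z : ℕ) : Set where
      plus  : + p ∣ + y * + z - a → PlusMinusQuotient a y z
      minus : + p ∣ + y * + z + a → PlusMinusQuotient a y z

    quotient-sym : ∀ {a y z} → PlusMinusQuotient a y z → PlusMinusQuotient a z y
    quotient-sym {a} {y} {z} (plus d)  = plus (∣-resp d (cong (_- a) (*-comm (+ y) (+ z))))
    quotient-sym {a} {y} {z} (minus d) = minus (∣-resp d (cong (_+ a) (*-comm (+ y) (+ z))))

    quotient-exists : ∀ a → ¬ (+ p ∣ a) → ∀ {y} → y ℕ.< h →
      ∃[ z ] (z ℕ.< h × PlusMinusQuotient a (suc y) (suc z))
    quotient-exists a p∤a {y} y<h with prime∤⇒unit pp (+ suc y) (suc∤ y<h)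
    ... | unit k yk≈1 with halfResidue (k * a) p∤ka
      where
      p∤ka : ¬ (+ p ∣ k * a)
      p∤ka p∣ka = p∤a (∣-combination (+ suc y) (- a) p∣ka yk≈1 (eq (+ suc y) k a))
        where
        eq : ∀ y k a → a ≡ y * (k * a) + (- a) * (y * k - 1ℤ)
        eq = solve-∀
    ...   | z , z<h , inj₁ z≈ = z , z<h ,
      plus (∣-combination (+ suc y) a z≈ yk≈1 (eq (+ suc y) k a (+ suc z)))
      where
      eq : ∀ y k a z → y * z - a ≡ y * (z - k * a) + a * (y * k - 1ℤ)
      eq = solve-∀
    ...   | z , z<h , inj₂ z≈ = z , z<h ,
      minus (∣-combination (+ suc y) (- a) z≈ yk≈1 (eq (+ suc y) k a (+ suc z)))
      where
      eq : ∀ y k a z → y * z + a ≡ y * (z + k * a) + (- a) * (y * k - 1ℤ)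
      eq = solve-∀

    -- After cancelling the common factor, equal signs give p ∣ Y - Z and opposite signs p ∣ Y + Z.
    -- The latter is impossible because 0 < Y + Z ≤ 2h < p.
    quotient-unique : ∀ a {x y z} → x ℕ.< h → y ℕ.< h → z ℕ.< h →
      PlusMinusQuotient a (suc x) (suc y) → PlusMinusQuotient a (suc x) (suc z) → y ≡ z
    quotient-unique a {x} {y} {z} x<h y<h z<h = go
      where
      X = + suc x
      Y = + suc y
      Z = + suc z
      same : + p ∣ X * (Y - Z) → y ≡ z
      same d with euclid pp X (Y - Z) d
      ... | inj₁ p∣x = ⊥-elim (suc∤ x<h p∣x)
      ... | inj₂ p∣  = ℕ.suc-injective (≈-small {p} p∣ (suc<p y<h) (suc<p z<h))
      opposite : + p ∣ X * (Y + Z) → y ≡ z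
      opposite d with euclid pp X (Y + Z) d
      ... | inj₁ p∣x = ⊥-elim (suc∤ x<h p∣x)
      ... | inj₂ p∣  = ⊥-elim (+∤ y<h z<h p∣)
      eq₁ : ∀ x y z a → x * (y - z) ≡ 1ℤ * (x * y - a) + -1ℤ * (x * z - a)
      eq₁ = solve-∀
      eq₂ : ∀ x y z a → x * (y + z) ≡ 1ℤ * (x * y - a) + 1ℤ * (x * z + a)
      eq₂ = solve-∀
      eq₃ : ∀ x y z a → x * (y + z) ≡ 1ℤ * (x * y + a) + 1ℤ * (x * z - a)
      eq₃ = solve-∀
      eq₄ : ∀ x y z a → x * (y - z) ≡ 1ℤ * (x * y + a) + -1ℤ * (x * z + a)
      eq₄ = solve-∀
      go : PlusMinusQuotient a (suc x) (suc y) → PlusMinusQuotient a (suc x) (suc z) → y ≡ z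
      go (plus d) (plus e) = same (∣-combination 1ℤ -1ℤ d e (eq₁ X Y Z a))
      go (plus d) (minus e) = opposite (∣-combination 1ℤ 1ℤ d e (eq₂ X Y Z a))
      go (minus d) (plus e) = opposite (∣-combination 1ℤ 1ℤ d e (eq₃ X Y Z a))
      go (minus d) (minus e) = same (∣-combination 1ℤ -1ℤ d e (eq₄ X Y Z a))

    -- y ↦ ± a / y is an involution of {1, …, h}, of odd size.
    ±square : ∀ m → h ≡ suc (m ℕ.+ m) → ∀ a → ¬ (+ p ∣ a) →
      ∃[ u ] (+ p ∣ u * u - a ⊎ + p ∣ u * u + a)
    ±square m h-odd a p∤a =
      let y , _ , Ryy = fixedPoint {R = PlusMinusQuotient a} m range
            (applyUpTo⁺₁ suc h λ i<j _ eq → ℕ.<⇒≢ i<j (ℕ.suc-injective eq))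
            (trans (length-applyUpTo suc h) h-odd)
            record { symmetric = quotient-sym {a} ; partner = partner ; functional = functional }
      in + y , [±] Ryy
      where
      [±] : ∀ {y} → PlusMinusQuotient a y y → + p ∣ + y * + y - a ⊎ + p ∣ + y * + y + a
      [±] (plus d)  = inj₁ d
      [±] (minus d) = inj₂ d
      range = applyUpTo suc h
      partner : ∀ {y} → y ∈ range → ∃[ z ] (z ∈ range × PlusMinusQuotient a y z)
      partner y∈ =
        let _ , y<h , y≡ = ∈-applyUpTo⁻ suc y∈
            z , z<h , Ryz = quotient-exists a p∤a y<h
        in suc z , ∈-applyUpTo⁺ suc z<h , subst (λ k → PlusMinusQuotient a k (suc z)) (sym y≡) Ryz
      functional : ∀ {x y z} → x ∈ range → y ∈ range → z ∈ range →
        PlusMinusQuotient a x y → PlusMinusQuotient a x z → y ≡ z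
      functional x∈ y∈ z∈ Rxy Rxz
        with ∈-applyUpTo⁻ suc x∈ | ∈-applyUpTo⁻ suc y∈ | ∈-applyUpTo⁻ suc z∈
      ... | _ , x<h , refl | _ , y<h , refl | _ , z<h , refl =
        cong suc (quotient-unique a x<h y<h z<h Rxy Rxz)

    p∤1 : ¬ (+ p ∣ 1ℤ)
    p∤1 = unit⇒prime∤ pp (unit-1 _)

    -- y ↦ ± 1 / y is an involution of {1, …, h} fixing 1, hence of {2, …, h},
    -- of odd size; a fixed point y satisfies y² ≡ ±1 and y ≢ ±1.
    √-1 : ∀ m → h ≡ suc (suc (m ℕ.+ m)) → ∃[ u ] (+ p ∣ u * u + 1ℤ)
    √-1 m h-even = fixed (fixedPoint {R = PlusMinusQuotient 1ℤ} m range
        (applyUpTo⁺₁ 2+_ (ℕ.pred h) λ i<j _ eq → ℕ.<⇒≢ i<j (ℕ.suc-injective (ℕ.suc-injective eq)))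
        (trans (length-applyUpTo 2+_ (ℕ.pred h)) (cong ℕ.pred h-even))
        record { symmetric = quotient-sym {1ℤ} ; partner = partner ; functional = functional })
      where
      2+_ : ℕ → ℕ
      2+ i = suc (suc i)
      h≡ : suc (ℕ.pred h) ≡ h
      h≡ = trans (cong (λ k → suc (ℕ.pred k)) h-even) (sym h-even)
      bound : ∀ {i} → i ℕ.< ℕ.pred h → suc i ℕ.< h
      bound {i} i< = subst (suc i ℕ.<_) h≡ (ℕ.s≤s i<)
      0<h : 0 ℕ.< h
      0<h = subst (0 ℕ.<_) h≡ (ℕ.s≤s ℕ.z≤n)
      range = applyUpTo 2+_ (ℕ.pred h)
      partner : ∀ {y} → y ∈ range → ∃[ z ] (z ∈ range × PlusMinusQuotient 1ℤ y z)
      partner y∈ =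
        let _ , y< , y≡ = ∈-applyUpTo⁻ 2+_ y∈
        in subst (λ k → ∃[ z ] (z ∈ range × PlusMinusQuotient 1ℤ k z)) (sym y≡)
             (not1 y< (quotient-exists 1ℤ p∤1 (bound y<)))
        where
        not1 : ∀ {y} → y ℕ.< ℕ.pred h → ∃[ z ] (z ℕ.< h × PlusMinusQuotient 1ℤ (2+ y) (suc z)) →
          ∃[ z ] (z ∈ range × PlusMinusQuotient 1ℤ (2+ y) z)
        not1 y< (suc z , z<h , Ryz) =
          2+ z , ∈-applyUpTo⁺ 2+_ (ℕ.≤-pred (subst (suc z ℕ.<_) (sym h≡) z<h)) , Ryz
        not1 y< (zero , _ , Ry1) =
          ⊥-elim (ℕ.1+n≢0 (quotient-unique 1ℤ 0<h (bound y<) 0<h (quotient-sym Ry1) (plus (divides 0ℤ refl))))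
      functional : ∀ {x y z} → x ∈ range → y ∈ range → z ∈ range →
        PlusMinusQuotient 1ℤ x y → PlusMinusQuotient 1ℤ x z → y ≡ z
      functional x∈ y∈ z∈ Rxy Rxz
        with ∈-applyUpTo⁻ 2+_ x∈ | ∈-applyUpTo⁻ 2+_ y∈ | ∈-applyUpTo⁻ 2+_ z∈
      ... | _ , x< , refl | _ , y< , refl | _ , z< , refl =
        cong suc (quotient-unique 1ℤ (bound x<) (bound y<) (bound z<) Rxy Rxz)
      eq₁ : ∀ y → (y - 1ℤ) * (y + 1ℤ) ≡ 1ℤ * (y * y - 1ℤ)
      eq₁ = solve-∀
      notOne : ∀ {y} → y ℕ.< ℕ.pred h → ¬ (+ p ∣ + (2+ y) * + (2+ y) - 1ℤ)
      notOne {y} y< d with euclid pp (+ (2+ y) - 1ℤ) (+ (2+ y) + 1ℤ) (∣-multiple 1ℤ d (eq₁ (+ (2+ y))))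
      ... | inj₁ p∣y-1 = ℕ.1+n≢0 (ℕ.suc-injective
        (≈-small {p} {2+ y} {1} p∣y-1 (suc<p (bound y<)) (suc<p 0<h)))
      ... | inj₂ p∣y+1 = +∤ (bound y<) 0<h p∣y+1
      fixed : ∃[ y ] (y ∈ range × PlusMinusQuotient 1ℤ y y) → ∃[ u ] (+ p ∣ u * u + 1ℤ)
      fixed (y , _  , minus y²≈-1) = + y , y²≈-1
      fixed (y , y∈ , plus y²≈1)   =
        let _ , y< , y≡ = ∈-applyUpTo⁻ 2+_ y∈
        in ⊥-elim (notOne y< (subst (λ k → + p ∣ + k * + k - 1ℤ) y≡ y²≈1))

    -- Pigeonhole: a root up to sign lies among 1, ..., h, and it determines its square, so the 2h
    -- nonzero residues cannot all have roots. Restricting roots to the half system makes the search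
    -- finite; `root` brings an arbitrary integer root into it.
    nonsquare : 0 ℕ.< h → ∃[ a ] (¬ (+ p ∣ a) × (∀ u → ¬ (+ p ∣ u * u - a)))
    nonsquare 0<h = conclude (Fin.¬∀⟶∃¬ (h ℕ.+ h) HasRoot HasRoot? notAll)
      where
      Root : Fin (h ℕ.+ h) → Fin h → Set
      Root i j = + p ∣ + suc (toℕ j) * + suc (toℕ j) - + suc (toℕ i)
      HasRoot : Fin (h ℕ.+ h) → Set
      HasRoot i = ∃ (Root i)
      HasRoot? : ∀ i → Dec (HasRoot i)
      HasRoot? i = Fin.any? λ j → + p ∣? (+ suc (toℕ j) * + suc (toℕ j) - + suc (toℕ i))
      suc∤p : ∀ (i : Fin (h ℕ.+ h)) → ¬ (+ p ∣ + suc (toℕ i))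
      suc∤p i p∣a = ℕ.1+n≢0 (∣-small {p} p∣a (ℕ.s≤s (Fin.toℕ<n i)))
      notAll : ¬ (∀ i → HasRoot i)
      notAll root = ℕ.<⇒≱ (ℕ.+-monoʳ-< h 0<h) (subst (h ℕ.+ h ℕ.≤_) (sym (ℕ.+-identityʳ h))
        (Fin.injective⇒≤ {f = λ i → proj₁ (root i)} injective))
        where
        injective : ∀ {i j} → proj₁ (root i) ≡ proj₁ (root j) → i ≡ j
        injective {i} {j} eq = Fin.toℕ-injective (ℕ.suc-injective (≈-small {p}
          (∣-combination -1ℤ 1ℤ (proj₂ (root i)) (subst (Root j) (sym eq) (proj₂ (root j)))
            (lemma (+ suc (toℕ (proj₁ (root i)))) (+ suc (toℕ i)) (+ suc (toℕ j))))
          (ℕ.s≤s (Fin.toℕ<n i)) (ℕ.s≤s (Fin.toℕ<n j))))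
          where
          lemma : ∀ r i j → i - j ≡ -1ℤ * (r * r - i) + 1ℤ * (r * r - j)
          lemma = solve-∀
      root : ∀ i u → + p ∣ u * u - + suc (toℕ i) → HasRoot i
      root i u u²≈a = reduce (halfResidue u λ p∣u → suc∤p i (∣-combination u -1ℤ p∣u u²≈a (eq₀ u a)))
        where
        a = + suc (toℕ i)
        eq₀ : ∀ u a → a ≡ u * u + -1ℤ * (u * u - a)
        eq₀ = solve-∀
        eq₁ : ∀ u z a → z * z - a ≡ (z + u) * (z - u) + 1ℤ * (u * u - a)
        eq₁ = solve-∀
        eq₂ : ∀ u z a → z * z - a ≡ (z - u) * (z + u) + 1ℤ * (u * u - a)
        eq₂ = solve-∀
        square : ∀ z → + p ∣ z - u ⊎ + p ∣ z + u → + p ∣ z * z - a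
        square z (inj₁ d) = ∣-combination (z + u) 1ℤ d u²≈a (eq₁ u z a)
        square z (inj₂ d) = ∣-combination (z - u) 1ℤ d u²≈a (eq₂ u z a)
        reduce : ∃[ z ] (z ℕ.< h × (+ p ∣ + suc z - u ⊎ + p ∣ + suc z + u)) → HasRoot i
        reduce (z , z<h , z≈) = fromℕ< z<h ,
          subst (λ k → + p ∣ + suc k * + suc k - a) (sym (Fin.toℕ-fromℕ< z<h)) (square (+ suc z) z≈)
      conclude : (∃[ i ] ¬ HasRoot i) → ∃[ a ] (¬ (+ p ∣ a) × (∀ u → ¬ (+ p ∣ u * u - a)))
      conclude (i , ¬root) = + suc (toℕ i) , suc∤p i , λ u u²≈a → ¬root (root i u u²≈a)

-- Signed sums of unit squares modulo a prime.

module LocalRepresentations where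

  open Congruence
  open QuadraticResidues
  open import Data.Empty using (⊥-elim)
  open import Data.Integer.Base using (ℤ; +_; 0ℤ; 1ℤ; -1ℤ; _+_; _*_; _-_; -_)
  open import Data.Integer.Divisibility.Signed using (_∣_; _∣?_; divides; ∣⇒∣ᵤ)
  open import Data.Integer.Tactic.RingSolver using (solve-∀)
  open import Data.List.Base using (List; []; _∷_; length)
  import Data.Nat as ℕ
  open import Data.Nat using (ℕ; suc; zero)
  import Data.Nat.Properties as ℕ
  import Data.Nat.Divisibility as ℕ
  import Data.Nat.DivMod as ℕ
  open import Data.Nat.Primality using (Prime; ¬prime[1]; prime[2]; prime?; prime⇒irreducible)
  open import Data.Nat.Tactic.RingSolver using () renaming (solve-∀ to solve-∀ℕ)
  open import Data.Product using (_×_; _,_; ∃-syntax)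
  import Data.Sign as Sign
  open import Data.Sign using (Sign)
  open import Data.Sum using (_⊎_; inj₁; inj₂)
  open import Relation.Binary.PropositionalEquality
  open import Relation.Nullary using (¬_; yes; no; Dec)
  open import Relation.Nullary.Decidable using (from-yes)

  pattern ⊕ = Sign.+
  pattern ⊖ = Sign.-

  odd%4 : ∀ n → ¬ (2 ℕ.∣ n) → n ℕ.% 4 ≡ 1 ⊎ n ℕ.% 4 ≡ 3
  odd%4 n odd = go (n ℕ.% 4) (ℕ.m≡m%n+[m/n]*n n 4) (ℕ.m%n<n n 4)
    where
    even : ∀ r → 2 ℕ.∣ r → ¬ (n ≡ r ℕ.+ n ℕ./ 4 ℕ.* 4)
    even r 2∣r n≡ = odd (subst (2 ℕ.∣_) (sym n≡) (ℕ.∣m∣n⇒∣m+n 2∣r (ℕ.∣n⇒∣m*n (n ℕ./ 4) (ℕ.divides 2 refl))))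
    go : ∀ r → n ≡ r ℕ.+ n ℕ./ 4 ℕ.* 4 → r ℕ.< 4 → r ≡ 1 ⊎ r ≡ 3
    go 0 n≡ _ = ⊥-elim (even 0 (ℕ.divides 0 refl) n≡)
    go 1 n≡ _ = inj₁ refl
    go 2 n≡ _ = ⊥-elim (even 2 (ℕ.divides 1 refl) n≡)
    go 3 n≡ _ = inj₂ refl
    go (suc (suc (suc (suc _)))) _ (ℕ.s≤s (ℕ.s≤s (ℕ.s≤s (ℕ.s≤s ()))))

  module 3mod4 {p} (pp : Prime p) (p%4 : p ℕ.% 4 ≡ 3) where
    private
      m = p ℕ./ 4
      -- p = 4m + 3 gives (p - 1) / 2 = 2m + 1, which is odd.
      h = suc (m ℕ.+ m)
      p≡ : p ≡ suc (h ℕ.+ h)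
      p≡ = trans (ℕ.m≡m%n+[m/n]*n p 4) (trans (cong (ℕ._+ m ℕ.* 4) p%4) (eq m))
        where
        eq : ∀ m → 3 ℕ.+ m ℕ.* 4 ≡ suc (suc (m ℕ.+ m) ℕ.+ suc (m ℕ.+ m))
        eq = solve-∀ℕ

    ±square : ∀ a → ¬ (+ p ∣ a) → ∃[ u ] (+ p ∣ u * u - a ⊎ + p ∣ u * u + a)
    ±square = subst
      (λ p → ∀ a → ¬ (+ p ∣ a) → ∃[ u ] (+ p ∣ u * u - a ⊎ + p ∣ u * u + a)) (sym p≡)
      (OddPrime.±square {h} (subst Prime p≡ pp) m refl)

    nonsquare : ∃[ a ] (¬ (+ p ∣ a) × (∀ u → ¬ (+ p ∣ u * u - a)))
    nonsquare = subst (λ p → ∃[ a ] (¬ (+ p ∣ a) × (∀ u → ¬ (+ p ∣ u * u - a)))) (sym p≡)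
      (OddPrime.nonsquare {h} (subst Prime p≡ pp) (ℕ.s≤s ℕ.z≤n))

    -- If −1 were a square, then every ± square would be a square.
    no√-1 : ∀ i → ¬ (+ p ∣ i * i + 1ℤ)
    no√-1 i i²≈-1 = let a , p∤a , ¬root = nonsquare ; u , u²≈±a = ±square a p∤a in contra a ¬root u u²≈±a
      where
      eq : ∀ i u a → (i * u) * (i * u) - a ≡ (u * u) * (i * i + 1ℤ) + -1ℤ * (u * u + a)
      eq = solve-∀
      contra : ∀ a → (∀ u → ¬ (+ p ∣ u * u - a)) → ∀ u → ¬ (+ p ∣ u * u - a ⊎ + p ∣ u * u + a)
      contra a ¬root u (inj₁ d) = ¬root u d
      contra a ¬root u (inj₂ d) = ¬root (i * u) (∣-combination (u * u) -1ℤ i²≈-1 d (eq i u a))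

  module 1mod4 {p} (pp : Prime p) (p%4 : p ℕ.% 4 ≡ 1) where
    private
      -- Chosen so that p = 4(m + 1) + 1 and h = 2m + 2, the shape required by `OddPrime.√-1`. The
      -- default value of `pred` at 0 is harmless, since p / 4 = 0 would mean p = 1.
      m = ℕ.pred (p ℕ./ 4)
      h = suc (suc (m ℕ.+ m))
      p≡ : p ≡ suc (h ℕ.+ h)
      p≡ = go (p ℕ./ 4) (trans (ℕ.m≡m%n+[m/n]*n p 4) (cong (ℕ._+ p ℕ./ 4 ℕ.* 4) p%4))
        where
        eq : ∀ m → 1 ℕ.+ suc m ℕ.* 4 ≡ suc (suc (suc (m ℕ.+ m)) ℕ.+ suc (suc (m ℕ.+ m)))
        eq = solve-∀ℕ
        go : ∀ k → p ≡ 1 ℕ.+ k ℕ.* 4 →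
          (let m = ℕ.pred k in p ≡ suc (suc (suc (m ℕ.+ m)) ℕ.+ suc (suc (m ℕ.+ m))))
        go zero    p≡1 = ⊥-elim (¬prime[1] (subst Prime p≡1 pp))
        go (suc m) p≡  = trans p≡ (eq m)

    √-1 : ∃[ i ] (+ p ∣ i * i + 1ℤ)
    √-1 = subst (λ p → ∃[ i ] (+ p ∣ i * i + 1ℤ)) (sym p≡) (OddPrime.√-1 {h} (subst Prime p≡ pp) m refl)

    nonsquare : ∃[ a ] (¬ (+ p ∣ a) × (∀ u → ¬ (+ p ∣ u * u - a)))
    nonsquare = subst (λ p → ∃[ a ] (¬ (+ p ∣ a) × (∀ u → ¬ (+ p ∣ u * u - a)))) (sym p≡)
      (OddPrime.nonsquare {h} (subst Prime p≡ pp) (ℕ.s≤s ℕ.z≤n))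

  unit-root : ∀ {p} → Prime p → ∀ a u → ¬ (+ p ∣ a) → + p ∣ u * u - a → IsUnit (+ p) u
  unit-root pp a u p∤a u²≈a =
    unit-factorˡ u u (unit-cong a (u * u) (≈-sym (u * u) a u²≈a) (prime∤⇒unit pp a p∤a))

  Rep[]⇒∣ : ∀ {d x} → Rep d [] x → d ∣ x
  Rep[]⇒∣ (done d∣x) = d∣x

  -- Multiplying a unit by a square root of −1 changes the sign of its square.
  Rep-signs : ∀ {p} → Prime p → ∀ i → + p ∣ i * i + 1ℤ → ∀ {σ} τ {x} → length σ ≡ length τ →
    Rep (+ p) σ x → Rep (+ p) τ x
  Rep-signs pp i i²≈-1 []      eq (done r) = done r
  Rep-signs {p} pp i i²≈-1 (t ∷ τ) {x} eq (term {s} u unit-u r) =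
    change s t (Rep-signs pp i i²≈-1 τ (ℕ.suc-injective eq) r)
    where
    unit-iu : IsUnit (+ p) (i * u)
    unit-iu = unit-* (unit-root pp -1ℤ i (unit⇒prime∤ pp (unit-neg (unit-1 _))) i²≈-1) unit-u
    eq₁ : ∀ x i u → (x - 1ℤ * (u * u)) - (x - -1ℤ * (i * u * (i * u))) ≡ (- (u * u)) * (i * i + 1ℤ)
    eq₁ = solve-∀
    eq₂ : ∀ x i u → (x - -1ℤ * (u * u)) - (x - 1ℤ * (i * u * (i * u))) ≡ (u * u) * (i * i + 1ℤ)
    eq₂ = solve-∀
    change : ∀ s t → Rep (+ p) τ (x - sgn s * (u * u)) → Rep (+ p) (t ∷ τ) x
    change ⊕ ⊕ r = term u unit-u r
    change ⊖ ⊖ r = term u unit-u r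
    change ⊕ ⊖ r = term (i * u) unit-iu
      (Rep-cong (x - 1ℤ * (u * u)) (x - -1ℤ * (i * u * (i * u))) (∣-multiple (- (u * u)) i²≈-1 (eq₁ x i u)) r)
    change ⊖ ⊕ r = term (i * u) unit-iu
      (Rep-cong (x - -1ℤ * (u * u)) (x - 1ℤ * (i * u * (i * u))) (∣-multiple (u * u) i²≈-1 (eq₂ x i u)) r)

  Rep-1∷ : ∀ {d} s {σ} x → Rep d σ (x - sgn s) → Rep d (s ∷ σ) x
  Rep-1∷ {d} s x r = term 1ℤ (unit-1 d)
    (Rep-cong (x - sgn s) (x - sgn s * (1ℤ * 1ℤ)) (divides 0ℤ (eq x (sgn s))) r)
    where
    eq : ∀ x s → (x - s) - (x - s * (1ℤ * 1ℤ)) ≡ 0ℤ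
    eq = solve-∀

  sum : List Sign → ℤ
  sum []      = 0ℤ
  sum (s ∷ σ) = sgn s + sum σ

  -- All units are taken to be 1.
  Rep-sum : ∀ {d} σ x → x ≈ sum σ mod d → Rep d σ x
  Rep-sum []      x x≈ = done (≈0⇒∣ x x≈)
  Rep-sum (s ∷ σ) x x≈ = Rep-1∷ s x (Rep-sum σ (x - sgn s) (∣-multiple 1ℤ x≈ (eq x (sgn s) (sum σ))))
    where
    eq : ∀ x s t → x - s - t ≡ 1ℤ * (x - (s + t))
    eq = solve-∀

  -- x = ((t + x/t)/2)² − ((t − x/t)/2)²
  Rep-⊕⊖ : ∀ {d} t x → IsUnit d (+ 2) → IsUnit d t → IsUnit d (t * t + x) → IsUnit d (t * t - x) →
    Rep d (⊕ ∷ ⊖ ∷ []) x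
  Rep-⊕⊖ {d} t x unit-2@(unit h 2h≈1) unit-t@(unit k tk≈1) unit₁ unit₂ =
    term u (unit-u x u refl unit₁) (term v (unit-u (- x) v refl unit₂) (done
      (∣-combination (- (x * (+ 2 * h + 1ℤ) * (t * k))) (- x) 2h≈1 tk≈1 (eq h k t x))))
    where
    -- `v` is `u` with `- x` for `x`. Both are units because (t ± x/t)/2 = (t² ± x)/2t.
    u = h * (t + x * k)
    v = h * (t + (- x) * k)
    eq : ∀ h k t x → (let u = h * (t + x * k) ; v = h * (t + (- x) * k) in
      (x - 1ℤ * (u * u)) - -1ℤ * (v * v)) ≡
      (- (x * (+ 2 * h + 1ℤ) * (t * k))) * (+ 2 * h - 1ℤ) + (- x) * (t * k - 1ℤ)
    eq = solve-∀
    eq′ : ∀ h k t x → h * k * (t * t + x) - h * (t + x * k) ≡ (h * t) * (t * k - 1ℤ)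
    eq′ = solve-∀
    unit-u : ∀ x u → u ≡ h * (t + x * k) → IsUnit d (t * t + x) → IsUnit d u
    unit-u x u refl unit₁ = unit-cong (h * k * (t * t + x)) u (∣-multiple (h * t) tk≈1 (eq′ h k t x))
      (unit-* (unit-* (unit-inverse unit-2) (unit-inverse unit-t)) unit₁)

  ∣prime⇒≡ : ∀ {p q} → Prime p → Prime q → p ℕ.∣ q → p ≡ q
  ∣prime⇒≡ pp qp p∣q with prime⇒irreducible qp p∣q
  ... | inj₁ refl = ⊥-elim (¬prime[1] pp)
  ... | inj₂ p≡q  = p≡q

  prime[3] : Prime 3
  prime[3] = from-yes (prime? 3)
  prime[5] : Prime 5
  prime[5] = from-yes (prime? 5)

  -- It suffices to find a unit `t` with t⁴ ≢ x², for then t² + x and t² - x are both units. If t =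
  -- 1 and t = 2 both failed, then `p` would divide 16 - 1 = 15.
  difference : ∀ {p} → Prime p → ¬ (p ≡ 2) → ¬ (p ≡ 3) → ¬ (p ≡ 5) → ∀ x → Rep (+ p) (⊕ ∷ ⊖ ∷ []) x
  difference {p} pp p≢2 p≢3 p≢5 x = go (+ p ∣? 1ℤ - x * x)
    where
    p∤2 : ¬ (+ p ∣ + 2)
    p∤2 p∣2 = p≢2 (∣prime⇒≡ pp prime[2] (∣⇒∣ᵤ p∣2))
    p∤1 : ¬ (+ p ∣ 1ℤ)
    p∤1 = unit⇒prime∤ pp (unit-1 _)
    p∤15 : ¬ (+ p ∣ + 15)
    p∤15 p∣15 with euclid pp (+ 3) (+ 5) p∣15
    ... | inj₁ p∣3 = p≢3 (∣prime⇒≡ pp prime[3] (∣⇒∣ᵤ p∣3))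
    ... | inj₂ p∣5 = p≢5 (∣prime⇒≡ pp prime[5] (∣⇒∣ᵤ p∣5))
    eq₁ : ∀ t x → t * t * (t * t) - x * x ≡ (t * t - x) * (t * t + x)
    eq₁ = solve-∀
    eq₂ : ∀ t x → t * t * (t * t) - x * x ≡ (t * t + x) * (t * t - x)
    eq₂ = solve-∀
    eq₃ : ∀ x → + 15 ≡ 1ℤ * (+ 16 - x * x) + -1ℤ * (1ℤ - x * x)
    eq₃ = solve-∀
    choose : ∀ t → ¬ (+ p ∣ t) → ¬ (+ p ∣ t * t * (t * t) - x * x) → Rep (+ p) (⊕ ∷ ⊖ ∷ []) x
    choose t p∤t p∤ = Rep-⊕⊖ t x (prime∤⇒unit pp (+ 2) p∤2) (prime∤⇒unit pp t p∤t)
      (prime∤⇒unit pp _ λ d → p∤ (∣-multiple (t * t - x) d (eq₁ t x)))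
      (prime∤⇒unit pp _ λ d → p∤ (∣-multiple (t * t + x) d (eq₂ t x)))
    go : Dec (+ p ∣ 1ℤ - x * x) → Rep (+ p) (⊕ ∷ ⊖ ∷ []) x
    go (no  p∤) = choose 1ℤ p∤1 p∤
    go (yes p∣) = choose (+ 2) p∤2 λ d → p∤15 (∣-combination 1ℤ -1ℤ d p∣ (eq₃ x))

  data Mod3 (x : ℤ) : Set where
    0mod3 : x ≈ 0ℤ mod + 3 → Mod3 x
    1mod3 : x ≈ 1ℤ mod + 3 → Mod3 x
    2mod3 : x ≈ -1ℤ mod + 3 → Mod3 x

  mod3 : ∀ x → Mod3 x
  mod3 x = go (residue 3 x)
    where
    go : ∃[ r ] (r ℕ.< 3 × x ≈ + r mod + 3) → Mod3 x
    go (0 , _ , d) = 0mod3 d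
    go (1 , _ , d) = 1mod3 d
    go (2 , _ , d) = 2mod3 (≈-trans x (+ 2) -1ℤ d (divides 1ℤ refl))
    go (suc (suc (suc _)) , ℕ.s≤s (ℕ.s≤s (ℕ.s≤s ())) , _)

  data Mod5 (x : ℤ) : Set where
    0mod5 : x ≈ 0ℤ mod + 5 → Mod5 x
    1mod5 : x ≈ 1ℤ mod + 5 → Mod5 x
    2mod5 : x ≈ + 2 mod + 5 → Mod5 x
    3mod5 : x ≈ + 3 mod + 5 → Mod5 x
    4mod5 : x ≈ + 4 mod + 5 → Mod5 x

  mod5 : ∀ x → Mod5 x
  mod5 x = go (residue 5 x)
    where
    go : ∃[ r ] (r ℕ.< 5 × x ≈ + r mod + 5) → Mod5 x
    go (0 , _ , d) = 0mod5 d
    go (1 , _ , d) = 1mod5 d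
    go (2 , _ , d) = 2mod5 d
    go (3 , _ , d) = 3mod5 d
    go (4 , _ , d) = 4mod5 d
    go (suc (suc (suc (suc (suc _)))) , ℕ.s≤s (ℕ.s≤s (ℕ.s≤s (ℕ.s≤s (ℕ.s≤s ())))) , _)

  -- A square congruent to -1 flips the sign in front of it, so `τ` keeps the length of `σ` but
  -- possibly not its signs.
  sum-≈ : ∀ {d} σ x → Rep d σ x → (∀ u → IsUnit d u → u * u ≈ 1ℤ mod d ⊎ u * u ≈ -1ℤ mod d) →
    ∃[ τ ] (length τ ≡ length σ × x ≈ sum τ mod d)
  sum-≈ _ x (done d∣x) _ = [] , refl , ∣⇒≈0 x d∣x
  sum-≈ {d} (_ ∷ σ) x (term {s} u unit-u r) square = go s (square u unit-u) (sum-≈ σ _ r square)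
    where
    eq : ∀ x s q t k → x - (s * k + t) ≡ 1ℤ * (x - s * q - t) + s * (q - k)
    eq = solve-∀
    close : ∀ s k {t} → x - s * (u * u) ≈ t mod d → u * u ≈ k mod d → x ≈ s * k + t mod d
    close s k {t} r e = ∣-combination 1ℤ s r e (eq x s (u * u) t k)
    go : ∀ s → u * u ≈ 1ℤ mod d ⊎ u * u ≈ -1ℤ mod d →
      ∃[ τ ] (length τ ≡ length σ × x - sgn s * (u * u) ≈ sum τ mod d) →
      ∃[ τ ] (length τ ≡ suc (length σ) × x ≈ sum τ mod d)
    go ⊕ (inj₁ e) (τ , len , r) = ⊕ ∷ τ , cong suc len , close 1ℤ 1ℤ r e
    go ⊕ (inj₂ e) (τ , len , r) = ⊖ ∷ τ , cong suc len , close 1ℤ -1ℤ r e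
    go ⊖ (inj₁ e) (τ , len , r) = ⊖ ∷ τ , cong suc len , close -1ℤ 1ℤ r e
    go ⊖ (inj₂ e) (τ , len , r) = ⊕ ∷ τ , cong suc len , close -1ℤ -1ℤ r e

  square-≈ : ∀ {d} u k → u ≈ k mod d → u * u ≈ k * k mod d
  square-≈ u k u≈k = ∣-multiple (u + k) u≈k (eq u k)
    where
    eq : ∀ u k → u * u - k * k ≡ (u + k) * (u - k)
    eq = solve-∀

  unit-≉0 : ∀ {p} → Prime p → ∀ {u} → IsUnit (+ p) u → ¬ (u ≈ 0ℤ mod + p)
  unit-≉0 pp {u} unit-u u≈0 = unit⇒prime∤ pp unit-u (≈0⇒∣ u u≈0)

  square-mod3 : ∀ u → IsUnit (+ 3) u → u * u ≈ 1ℤ mod + 3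
  square-mod3 u unit-u = go (mod3 u)
    where
    go : Mod3 u → u * u ≈ 1ℤ mod + 3
    go (0mod3 d) = ⊥-elim (unit-≉0 prime[3] unit-u d)
    go (1mod3 d) = square-≈ u 1ℤ d
    go (2mod3 d) = square-≈ u -1ℤ d

  square-mod5 : ∀ u → IsUnit (+ 5) u → u * u ≈ 1ℤ mod + 5 ⊎ u * u ≈ -1ℤ mod + 5
  square-mod5 u unit-u = go (mod5 u)
    where
    go : Mod5 u → u * u ≈ 1ℤ mod + 5 ⊎ u * u ≈ -1ℤ mod + 5
    go (0mod5 d) = ⊥-elim (unit-≉0 prime[5] unit-u d)
    go (1mod5 d) = inj₁ (square-≈ u 1ℤ d)
    go (2mod5 d) = inj₂ (≈-trans (u * u) (+ 4) -1ℤ (square-≈ u (+ 2) d) (divides 1ℤ refl))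
    go (3mod5 d) = inj₂ (≈-trans (u * u) (+ 9) -1ℤ (square-≈ u (+ 3) d) (divides (+ 2) refl))
    go (4mod5 d) = inj₁ (≈-trans (u * u) (+ 16) 1ℤ (square-≈ u (+ 4) d) (divides (+ 3) refl))

  Rep-mod3 : ∀ {σ x} → Rep (+ 3) σ x → x ≈ sum σ mod + 3
  Rep-mod3 {x = x} (done d∣x) = ∣⇒≈0 x d∣x
  Rep-mod3 {s ∷ σ} {x} (term u unit-u r) =
    ∣-combination 1ℤ (sgn s) (Rep-mod3 r) (square-mod3 u unit-u) (eq x (sgn s) (u * u) (sum σ))
    where
    eq : ∀ x s q t → x - (s + t) ≡ 1ℤ * (x - s * q - t) + s * (q - 1ℤ)
    eq = solve-∀

  Rep-mod5 : ∀ {σ x} → Rep (+ 5) σ x → ∃[ τ ] (length τ ≡ length σ × x ≈ sum τ mod + 5)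
  Rep-mod5 r = sum-≈ _ _ r square-mod5

  √-1-mod5 : + 5 ∣ + 2 * + 2 + 1ℤ
  √-1-mod5 = divides 1ℤ refl

  -- As 2² ≡ -1 modulo 5, only the length of the list of signs matters there.
  Rep5-sum : ∀ {σ} τ {x} → length τ ≡ length σ → x ≈ sum τ mod + 5 → Rep (+ 5) σ x
  Rep5-sum {σ} τ {x} eq x≈ = Rep-signs prime[5] (+ 2) √-1-mod5 σ eq (Rep-sum τ x x≈)

  ¬Rep-singleton : ∀ {p} → Prime p → ∀ {s x} → + p ∣ x → ¬ Rep (+ p) (s ∷ []) x
  ¬Rep-singleton {p} pp {s} {x} p∣x (term u unit-u (done d)) = contra s d
    where
    eq₁ : ∀ x q → q ≡ 1ℤ * x + -1ℤ * (x - 1ℤ * q)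
    eq₁ = solve-∀
    eq₂ : ∀ x q → q ≡ -1ℤ * x + 1ℤ * (x - -1ℤ * q)
    eq₂ = solve-∀
    p∤ : ¬ (+ p ∣ u * u)
    p∤ = unit⇒prime∤ pp (unit-* unit-u unit-u)
    contra : ∀ s → ¬ (+ p ∣ x - sgn s * (u * u))
    contra ⊕ d = p∤ (∣-combination 1ℤ -1ℤ p∣x d (eq₁ x (u * u)))
    contra ⊖ d = p∤ (∣-combination -1ℤ 1ℤ p∣x d (eq₂ x (u * u)))

  -- u² + v² ≡ 0 would make u / v a square root of −1.
  ¬Rep-pair : ∀ {p} → Prime p → p ℕ.% 4 ≡ 3 → ∀ {s x} → + p ∣ x → ¬ Rep (+ p) (s ∷ s ∷ []) x
  ¬Rep-pair {p} pp p%4 {s} {x} p∣x (term u unit-u (term v (unit w vw≈1) (done d))) = contra s d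
    where
    eq : ∀ q w v → q * w * (q * w) + 1ℤ ≡ (w * w) * (q * q + v * v) + (- (v * w + 1ℤ)) * (v * w - 1ℤ)
    eq = solve-∀
    eq₁ : ∀ x q r → q + r ≡ 1ℤ * x + -1ℤ * (x - 1ℤ * q - 1ℤ * r)
    eq₁ = solve-∀
    eq₂ : ∀ x q r → q + r ≡ -1ℤ * x + 1ℤ * (x - -1ℤ * q - -1ℤ * r)
    eq₂ = solve-∀
    p∤ : ¬ (+ p ∣ u * u + v * v)
    p∤ e = 3mod4.no√-1 pp p%4 (u * w) (∣-combination (w * w) (- (v * w + 1ℤ)) e vw≈1 (eq u w v))
    contra : ∀ s → ¬ (+ p ∣ x - sgn s * (u * u) - sgn s * (v * v))
    contra ⊕ d = p∤ (∣-combination 1ℤ -1ℤ p∣x d (eq₁ x (u * u) (v * v)))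
    contra ⊖ d = p∤ (∣-combination -1ℤ 1ℤ p∣x d (eq₂ x (u * u) (v * v)))

-- Walks in `G n` and representations modulo `n`.

module Walks where

  open Congruence
  open QuadraticResidues
  open LocalRepresentations
  open import Defs
  open import Algebra.Bundles using (CommutativeRing)
  open import Data.Empty using (⊥-elim)
  open import Data.Fin.Base using (Fin; toℕ; fromℕ<)
  import Data.Fin.Properties as Fin
  open import Data.Integer.Base using (ℤ; +_; 0ℤ; 1ℤ; -1ℤ; _+_; _*_; _-_; -_)
  open import Data.Integer.Divisibility.Signed
    using (divides; ∣-refl; ∣m∣n⇒∣m+n; ∣m∣n⇒∣m-n; ∣n⇒∣m*n)
  open import Data.Integer.Properties using (pos-*; pos-+; m-n≡m⊖n; ⊖-≥)
  open import Data.Integer.Tactic.RingSolver using (solve-∀)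
  open import Data.List.Base using ([]; _∷_; length)
  import Data.Nat as ℕ
  open import Data.Nat using (ℕ; suc; zero)
  import Data.Nat.Properties as ℕ
  import Data.Nat.DivMod as ℕ
  open import Data.Product using (_×_; _,_; ∃-syntax)
  open import Data.Sum using (_⊎_; inj₁; inj₂)
  open import Relation.Binary.PropositionalEquality
  open import Relation.Nullary using (yes; no; Dec)
  open import Relation.Nullary.Decidable using (_×-dec_; _⊎-dec_; map′)

  least : ∀ {P : ℕ → Set} → (∀ k → Dec (P k)) → ∀ k → P k → ∃[ d ] (P d × (∀ j → P j → d ℕ.≤ j) × d ℕ.≤ k)
  least P? k Pk with P? 0
  ... | yes P0 = 0 , P0 , (λ _ _ → ℕ.z≤n) , ℕ.z≤n
  least P? zero    Pk | no ¬P0 = ⊥-elim (¬P0 Pk)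
  least {P} P? (suc k) Pk | no ¬P0 with least (λ j → P? (suc j)) k Pk
  ... | d , Pd , minimal , d≤k = suc d , Pd , minimal′ , ℕ.s≤s d≤k
    where
    minimal′ : ∀ j → P j → suc d ℕ.≤ j
    minimal′ zero    P0 = ⊥-elim (¬P0 P0)
    minimal′ (suc j) Pj = ℕ.s≤s (minimal j Pj)

  module _ (n : ℕ) .{{_ : ℕ.NonZero n}} where

    private
      module R = CommutativeRing (ℤ/ n)


      unit? : ∀ a → Dec (Unit n a)
      unit? a = Fin.any? λ b → (b R.* a Fin.≟ R.1#) ×-dec (a R.* b Fin.≟ R.1#)

      T? : ∀ t → Dec (T n t)
      T? t = Fin.any? λ u → unit? u ×-dec ((t Fin.≟ u R.* u) ⊎-dec (t Fin.≟ R.- (u R.* u)))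

    -- `IsDistance` demands a least walk length. It is obtained constructively by deciding for each
    -- length whether there is a walk, the next vertex being searched for in the finite vertex set.
    walk? : ∀ k u v → Dec (Walk (G n) u v k)
    walk? zero    u v = map′ (λ { refl → [] }) (λ { [] → refl }) (u Fin.≟ v)
    walk? (suc k) u v = map′ (λ { (_ , e , w) → e ∷ w }) (λ { (e ∷ w) → _ , e , w })
      (Fin.any? λ w → T? (u R.- w) ×-dec walk? k w v)

    distance : ∀ k u v → Walk (G n) u v k → ∃[ d ] (IsDistance (G n) u v d × d ℕ.≤ k)
    distance k u v w =
      let d , w′ , minimal , d≤k = least (λ k → walk? k u v) k w
      in d , (w′ , minimal) , d≤k

    -- For the extremal pair, the upper bound applied to it and the lower bound on all its walks
    -- force the distance to be exactly `D`.
    isDiameter : ∀ D → (∀ u v → ∃[ k ] (Walk (G n) u v k × k ℕ.≤ D)) →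
      ∃[ u ] ∃[ v ] (∀ k → Walk (G n) u v k → D ℕ.≤ k) → IsDiameter (G n) D
    isDiameter D upper (u , v , lower) = bounded , u , v , attained (bounded u v)
      where
      bounded : ∀ u v → ∃[ k ] (IsDistance (G n) u v k × k ℕ.≤ D)
      bounded u v =
        let k , w , k≤D = upper u v
            d , isDistance , d≤k = distance k u v w
        in d , isDistance , ℕ.≤-trans d≤k k≤D
      attained : ∃[ k ] (IsDistance (G n) u v k × k ℕ.≤ D) → IsDistance (G n) u v D
      attained (k , (w , minimal) , k≤D) =
        subst (IsDistance (G n) u v) (ℕ.≤-antisym k≤D (lower k w)) (w , minimal)

    private
      rep : Fin n → ℤ
      rep a = + toℕ a

      rep-mod : ∀ k → rep (k ℕ.mod n) ≈ + k mod + n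
      rep-mod k = subst (λ r → + r ≈ + k mod + n) (sym (Mod.toℕ-mod n k))
        (divides (- + (k ℕ./ n)) (trans (cong (λ j → + (k ℕ.% n) - j) eq)
          (cancel (+ (k ℕ.% n)) (+ (k ℕ./ n)) (+ n))))
        where
        eq : + k ≡ + (k ℕ.% n) + + (k ℕ./ n) * + n
        eq = trans (cong +_ (ℕ.m≡m%n+[m/n]*n k n))
          (trans (pos-+ (k ℕ.% n) (k ℕ./ n ℕ.* n)) (cong (λ j → + (k ℕ.% n) + j) (pos-* (k ℕ./ n) n)))
        cancel : ∀ r q n → r - (r + q * n) ≡ - q * n
        cancel = solve-∀

      rep-+ : ∀ a b → rep (a R.+ b) ≈ rep a + rep b mod + n
      rep-+ a b = ∣-resp (rep-mod (toℕ a ℕ.+ toℕ b)) (cong (λ k → rep (a R.+ b) - k) (pos-+ (toℕ a) (toℕ b)))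

      rep-* : ∀ a b → rep (a R.* b) ≈ rep a * rep b mod + n
      rep-* a b = ∣-resp (rep-mod (toℕ a ℕ.* toℕ b)) (cong (λ k → rep (a R.* b) - k) (pos-* (toℕ a) (toℕ b)))

      rep-neg : ∀ a → rep (R.- a) ≈ - rep a mod + n
      rep-neg a = ∣-combination 1ℤ 1ℤ (rep-mod (n ℕ.∸ toℕ a)) ∣-refl
        (trans (eq (rep (R.- a)) (+ n) (rep a)) (cong (λ k → 1ℤ * (rep (R.- a) - k) + 1ℤ * + n) n-a))
        where
        n-a : + n - rep a ≡ + (n ℕ.∸ toℕ a)
        n-a = trans (m-n≡m⊖n n (toℕ a)) (⊖-≥ (Fin.toℕ≤n a))
        eq : ∀ r n a → r - - a ≡ 1ℤ * (r - (n - a)) + 1ℤ * n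
        eq = solve-∀

      rep-injective : ∀ a b → rep a ≈ rep b mod + n → a ≡ b
      rep-injective a b a≈b = Fin.toℕ-injective (≈-small {n} a≈b (Fin.toℕ<n a) (Fin.toℕ<n b))

      abstract
        unrep : ∀ x → ∃[ a ] (rep a ≈ x mod + n)
        unrep x = let r , r<n , x≈r = residue n x in fromℕ< r<n ,
          subst (λ k → + k ≈ x mod + n) (sym (Fin.toℕ-fromℕ< r<n)) (≈-sym x (+ r) x≈r)

      rep-unit : ∀ u → Unit n u → IsUnit (+ n) (rep u)
      rep-unit u (v , _ , uv≡1) = unit (rep v)
        (≈-trans (rep u * rep v) (rep (u R.* v)) 1ℤ (≈-sym (rep (u R.* v)) (rep u * rep v) (rep-* u v))
          (subst (λ w → rep w ≈ 1ℤ mod + n) (sym uv≡1) (rep-mod 1)))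

      unrep-unit : ∀ u → IsUnit (+ n) (rep u) → Unit n u
      unrep-unit u (unit y uy≈1) =
        let v , v≈y = unrep y
            uv≡1 = rep-injective (u R.* v) R.1#
              (≈-trans (rep (u R.* v)) (rep u * rep v) (rep R.1#) (rep-* u v)
              (≈-trans (rep u * rep v) 1ℤ (rep R.1#)
                (∣-combination (rep u) 1ℤ v≈y uy≈1 (eq (rep u) (rep v) y))
                (≈-sym (rep R.1#) 1ℤ (rep-mod 1))))
        in v , trans (R.*-comm v u) uv≡1 , uv≡1
        where
        eq : ∀ u v y → u * v - 1ℤ ≡ u * (v - y) + 1ℤ * (u * y - 1ℤ)
        eq = solve-∀

      SignedUnitSquare : ℤ → Set
      SignedUnitSquare x = ∃[ s ] ∃[ u ] (IsUnit (+ n) u × x ≈ sgn s * (u * u) mod + n)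

      T⇒signed : ∀ t → T n t → SignedUnitSquare (rep t)
      T⇒signed t (u , unit-u , inj₁ refl) = ⊕ , rep u , rep-unit u unit-u ,
        ∣-resp (rep-* u u) (eq (rep (u R.* u)) (rep u * rep u))
        where
        eq : ∀ x y → x - y ≡ x - 1ℤ * y
        eq = solve-∀
      T⇒signed t (u , unit-u , inj₂ refl) = ⊖ , rep u , rep-unit u unit-u ,
        ∣-combination 1ℤ -1ℤ (rep-neg (u R.* u)) (rep-* u u) (eq (rep t) (rep (u R.* u)) (rep u * rep u))
        where
        eq : ∀ x y z → x - -1ℤ * z ≡ 1ℤ * (x - - y) + -1ℤ * (y - z)
        eq = solve-∀

      signed⇒T : ∀ t → SignedUnitSquare (rep t) → T n t
      signed⇒T t (s , x , unit-x , t≈) = let u , u≈x = unrep x in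
        u , unrep-unit u (unit-cong x (rep u) (≈-sym (rep u) x u≈x) unit-x) , go s u u≈x t≈
        where
        eq₁ : ∀ t v u x → t - v ≡ 1ℤ * (t - 1ℤ * (x * x)) + 1ℤ * (- (u + x) * (u - x) - (v - u * u))
        eq₁ = solve-∀
        eq₂ : ∀ t w v u x → t - w ≡
          1ℤ * (t - -1ℤ * (x * x)) + 1ℤ * ((u + x) * (u - x) - (w - - v) + (v - u * u))
        eq₂ = solve-∀
        go : ∀ s u → rep u ≈ x mod + n → rep t ≈ sgn s * (x * x) mod + n → t ≡ u R.* u ⊎ t ≡ R.- (u R.* u)
        go ⊕ u u≈x t≈ = inj₁ (rep-injective t (u R.* u) (∣-combination 1ℤ 1ℤ t≈
          (∣m∣n⇒∣m-n (∣n⇒∣m*n (- (rep u + x)) u≈x) (rep-* u u))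
          (eq₁ (rep t) (rep (u R.* u)) (rep u) x)))
        go ⊖ u u≈x t≈ = inj₂ (rep-injective t (R.- (u R.* u)) (∣-combination 1ℤ 1ℤ t≈
          (∣m∣n⇒∣m+n (∣m∣n⇒∣m-n (∣n⇒∣m*n (rep u + x) u≈x) (rep-neg (u R.* u))) (rep-* u u))
          (eq₂ (rep t) (rep (R.- (u R.* u))) (rep (u R.* u)) (rep u) x)))

      rep-- : ∀ a b → rep (a R.- b) ≈ rep a - rep b mod + n
      rep-- a b = ∣-combination 1ℤ 1ℤ (rep-+ a (R.- b)) (rep-neg b)
        (eq (rep (a R.- b)) (rep a) (rep (R.- b)) (rep b))
        where
        eq : ∀ c a m b → c - (a - b) ≡ 1ℤ * (c - (a + m)) + 1ℤ * (m - - b)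
        eq = solve-∀

    -- The differences along the walk telescope, and each edge contributes one signed unit square.
    walk⇒Rep : ∀ {a b k} → Walk (G n) a b k → ∃[ σ ] (length σ ≡ k × Rep (+ n) σ (rep a - rep b))
    walk⇒Rep {a} [] = [] , refl , done (divides 0ℤ (eq (rep a)))
      where
      eq : ∀ a → a - a ≡ 0ℤ
      eq = solve-∀
    walk⇒Rep {a} {b} (_∷_ {v = c} e w) =
      let σ , len , r = walk⇒Rep w
          s , u , unit-u , d = T⇒signed (a R.- c) e
      in s ∷ σ , cong suc len , term u unit-u
           (Rep-cong (rep c - rep b) (rep a - rep b - sgn s * (u * u))
             (∣-combination 1ℤ -1ℤ (rep-- a c) d
               (eq (rep a) (rep b) (rep c) (rep (a R.- c)) (sgn s * (u * u)))) r)
      where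
      eq : ∀ a b c d q → (c - b) - (a - b - q) ≡ 1ℤ * (d - (a - c)) + -1ℤ * (d - q)
      eq = solve-∀

    -- The vertex after `a` is a - s u². The represented integer `x` is only required to be
    -- congruent to the difference, so that the recursion takes the rest of the representation as it
    -- stands.
    Rep⇒walk : ∀ σ a b x → rep a - rep b ≈ x mod + n → Rep (+ n) σ x → Walk (G n) a b (length σ)
    Rep⇒walk [] a b x a-b≈x (done d) = subst (λ c → Walk (G n) a c 0) (rep-injective a b
      (∣-≈ x (rep a - rep b) d (≈-sym (rep a - rep b) x a-b≈x))) []
    Rep⇒walk (s ∷ σ) a b x a-b≈x (term u unit-u r) =
      let c , c≈ = unrep (rep a - sgn s * (u * u)) in
      signed⇒T (a R.- c) (s , u , unit-u ,
        ∣-combination 1ℤ -1ℤ (rep-- a c) c≈ (eq₁ (rep (a R.- c)) (rep a) (rep c) (sgn s * (u * u)))) ∷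
      Rep⇒walk σ c b (x - sgn s * (u * u))
        (∣-combination 1ℤ 1ℤ c≈ a-b≈x (eq₂ (rep a) (rep b) (rep c) x (sgn s * (u * u)))) r
      where
      eq₁ : ∀ d a c q → d - q ≡ 1ℤ * (d - (a - c)) + -1ℤ * (c - (a - q))
      eq₁ = solve-∀
      eq₂ : ∀ a b c x q → (c - b) - (x - q) ≡ 1ℤ * (c - (a - q)) + 1ℤ * (a - b - x)
      eq₂ = solve-∀

    -- The graph is invariant under translation, so distances depend on differences alone. The
    -- extremal difference `x` is realised by the vertices of `x` and 0.
    isDiameter-Rep : ∀ D → (∀ x → ∃[ σ ] (length σ ℕ.≤ D × Rep (+ n) σ x)) →
      ∃[ x ] (∀ σ → Rep (+ n) σ x → D ℕ.≤ length σ) → IsDiameter (G n) D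
    isDiameter-Rep D upper (x , lower) = isDiameter D
      (λ a b → let σ , len , r = upper (rep a - rep b) in
         length σ , Rep⇒walk σ a b (rep a - rep b) (divides 0ℤ (eq₀ (rep a - rep b))) r , len)
      (let a , a≈x = unrep x ; b , b≈0 = unrep 0ℤ in a , b , λ k w →
         let σ , len , r = walk⇒Rep w in
         subst (D ℕ.≤_) len (lower σ (Rep-cong (rep a - rep b) x
           (∣-combination 1ℤ -1ℤ a≈x b≈0 (eq₁ (rep a) (rep b) x)) r)))
      where
      eq₀ : ∀ a → a - a ≡ 0ℤ
      eq₀ = solve-∀
      eq₁ : ∀ a b x → a - b - x ≡ 1ℤ * (a - x) + -1ℤ * (b - 0ℤ)
      eq₁ = solve-∀

-- Prime factors of `n` and obstructions at 3 and 5.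

module Diameters where

  open Congruence
  open QuadraticResidues
  open LocalRepresentations
  open Walks
  open import Defs
  open import Data.Empty using (⊥-elim)
  open import Data.Integer.Base using (ℤ; +_; 0ℤ; 1ℤ; -1ℤ; _+_; _*_; _-_; -_)
  open import Data.Integer.Divisibility.Signed
    using (_∣_; _∣?_; divides; ∣-refl; ∣⇒∣ᵤ; ∣-trans; ∣m⇒∣m*n)
  open import Data.Integer.Tactic.RingSolver using (solve-∀)
  open import Data.List.Base using (List; []; _∷_; length; upTo)
  open import Data.List.Membership.Propositional using (_∈_; find; lose)
  open import Data.List.Membership.Propositional.Properties using (∈-filter⁺; ∈-filter⁻; ∈-upTo⁺)
  open import Data.List.Relation.Unary.All as All using (All)
  open import Data.List.Relation.Unary.AllPairs as AllPairs using ()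
  open import Data.List.Relation.Unary.Any using (here; there; Any; any?)
  open import Data.List.Relation.Unary.Unique.Propositional using (Unique)
  open import Data.List.Relation.Unary.Unique.Propositional.Properties using (upTo⁺; filter⁺)
  import Data.Nat as ℕ
  open import Data.Nat using (ℕ; suc; zero)
  import Data.Nat.Properties as ℕ
  import Data.Nat.Divisibility as ℕ
  import Data.Nat.DivMod as ℕ
  open import Data.Nat.Primality
    using (Prime; prime?; Composite; composite⇒¬prime; ¬prime⇒composite)
  open import Data.Nat.Primality.Factorisation using (PrimeFactorisation; factorise)
  open import Data.Nat.ListAction using (product)
  open import Data.Product using (_×_; _,_; ∃-syntax; proj₂)
  open import Data.Sign using (Sign)
  open import Data.Sum using (_⊎_; inj₁; inj₂)
  open import Relation.Binary.PropositionalEquality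
  open import Relation.Nullary using (¬_; yes; no; Dec)
  open import Relation.Nullary.Decidable using (_×-dec_; False; toWitnessFalse)

  indicator-yes : ∀ {P} (P? : Dec P) → P → indicator P? ≡ 1
  indicator-yes (yes _) p = refl
  indicator-yes (no ¬p) p = ⊥-elim (¬p p)

  indicator-no : ∀ {P} (P? : Dec P) → ¬ P → indicator P? ≡ 0
  indicator-no (yes p) ¬p = ⊥-elim (¬p p)
  indicator-no (no _)  ¬p = refl

  module _ (n : ℕ) .{{_ : ℕ.NonZero n}} where

    primeFactor? : ∀ p → Dec (Prime p × p ℕ.∣ n)
    primeFactor? p = prime? p ×-dec p ℕ.∣? n

    ∈primeFactors⁺ : ∀ {p} → Prime p → p ℕ.∣ n → p ∈ primeFactors n
    ∈primeFactors⁺ pp p∣n = ∈-filter⁺ primeFactor? (∈-upTo⁺ (ℕ.s≤s (ℕ.∣⇒≤ p∣n))) (pp , p∣n)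

    ∈primeFactors⁻ : ∀ {p} → p ∈ primeFactors n → Prime p × p ℕ.∣ n
    ∈primeFactors⁻ p∈ = proj₂ (∈-filter⁻ primeFactor? {xs = upTo (suc n)} p∈)

    uniquePrimeFactor : ω n ≡ 1 → ∃[ p ] (Prime p × p ℕ.∣ n × (∀ q → Prime q → q ℕ.∣ n → q ≡ p))
    uniquePrimeFactor = go (primeFactors n) ∈primeFactors⁺ ∈primeFactors⁻
      where
      go : ∀ ps → (∀ {p} → Prime p → p ℕ.∣ n → p ∈ ps) → (∀ {p} → p ∈ ps → Prime p × p ℕ.∣ n) →
        length ps ≡ 1 → ∃[ p ] (Prime p × p ℕ.∣ n × (∀ q → Prime q → q ℕ.∣ n → q ≡ p))
      go (p ∷ []) ∈⁺ ∈⁻ refl = let pp , p∣n = ∈⁻ (here refl) in p , pp , p∣n , λ q qp q∣n → only (∈⁺ qp q∣n)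
        where
        only : ∀ {q} → q ∈ p ∷ [] → q ≡ p
        only (here q≡p) = q≡p

    twoPrimeFactors : 1 ℕ.< ω n → ∃[ p ] ∃[ q ] (Prime p × p ℕ.∣ n × Prime q × q ℕ.∣ n × ¬ (p ≡ q))
    twoPrimeFactors = go (primeFactors n) (filter⁺ primeFactor? (upTo⁺ (suc n))) ∈primeFactors⁻
      where
      go : ∀ ps → Unique ps → (∀ {p} → p ∈ ps → Prime p × p ℕ.∣ n) → 1 ℕ.< length ps →
        ∃[ p ] ∃[ q ] (Prime p × p ℕ.∣ n × Prime q × q ℕ.∣ n × ¬ (p ≡ q))
      go (p ∷ q ∷ ps) unique ∈⁻ _ =
        let pp , p∣n = ∈⁻ (here refl) ; qp , q∣n = ∈⁻ (there (here refl))
        in p , q , pp , p∣n , qp , q∣n , All.head (AllPairs.head unique)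
      go (p ∷ []) _ _ (ℕ.s≤s ())

    primeDivisor : 1 ℕ.< n → ∃[ p ] (Prime p × p ℕ.∣ n)
    primeDivisor = go factors factorsPrime isFactorisation
      where
      open PrimeFactorisation (factorise n)
      go : ∀ ps → All Prime ps → n ≡ product ps → 1 ℕ.< n → ∃[ p ] (Prime p × p ℕ.∣ n)
      go []       _             refl (ℕ.s≤s ())
      go (p ∷ ps) (pp All.∷ _) eq   _  = p , pp , subst (p ℕ.∣_) (sym eq) (ℕ.m∣m*n (product ps))

  -- Supplies the extremal differences for the lower bounds: being 1 at one prime and 0 at others
  -- puts the local conditions in conflict.
  oneModulo : ∀ {k} → Prime k → ∀ m → ¬ (+ k ∣ m) → ∃[ x ] (x ≈ 1ℤ mod + k × m ∣ x)
  oneModulo kp m k∤m = let unit y my≈1 = prime∤⇒unit kp m k∤m in m * y , my≈1 , ∣m⇒∣m*n y ∣-refl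

  prime∤prime : ∀ {p q} → Prime p → Prime q → ¬ (p ≡ q) → ¬ (+ p ∣ + q)
  prime∤prime pp qp p≢q p∣q = p≢q (∣prime⇒≡ pp qp (∣⇒∣ᵤ p∣q))

  1≉0 : ∀ {p x} → Prime p → x ≈ 1ℤ mod + p → ¬ (+ p ∣ x)
  1≉0 {x = x} pp x≈1 p∣x = unit⇒prime∤ pp (unit-1 _) (∣-≈ x 1ℤ p∣x x≈1)

  -- For numerals `k`, `j` and `d` the implicit argument is settled by evaluating the divisibility
  -- test.
  ≉-mod : ∀ x k j d → x ≈ k mod + d → {False (+ d ∣? k - j)} → ¬ (x ≈ j mod + d)
  ≉-mod x k j d x≈k {k≉j} x≈j =
    toWitnessFalse k≉j (≈-trans k x j (≈-sym x k x≈k) x≈j)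

  -- Two signs sum to 0 or ± 2, never to 1 modulo 5.
  ¬Rep-mod5-2 : ∀ {s t x} → x ≈ 1ℤ mod + 5 → ¬ Rep (+ 5) (s ∷ t ∷ []) x
  ¬Rep-mod5-2 {x = x} x≈1 r = go (Rep-mod5 r)
    where
    go : ¬ (∃[ τ ] (length τ ≡ 2 × x ≈ sum τ mod + 5))
    go (⊕ ∷ ⊕ ∷ [] , refl , e) = ≉-mod x 1ℤ (+ 2) 5 x≈1 e
    go (⊕ ∷ ⊖ ∷ [] , refl , e) = ≉-mod x 1ℤ 0ℤ 5 x≈1 e
    go (⊖ ∷ ⊕ ∷ [] , refl , e) = ≉-mod x 1ℤ 0ℤ 5 x≈1 e
    go (⊖ ∷ ⊖ ∷ [] , refl , e) = ≉-mod x 1ℤ (- (+ 2)) 5 x≈1 e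

  -- Three signs sum to ± 1 or ± 3, never to 0 modulo 5.
  ¬Rep-mod5-3 : ∀ {s t u x} → + 5 ∣ x → ¬ Rep (+ 5) (s ∷ t ∷ u ∷ []) x
  ¬Rep-mod5-3 {x = x} 5∣x r = go (Rep-mod5 r)
    where
    go : ¬ (∃[ τ ] (length τ ≡ 3 × x ≈ sum τ mod + 5))
    go (⊕ ∷ ⊕ ∷ ⊕ ∷ [] , refl , e) = ≉-mod x 0ℤ (+ 3) 5 (∣⇒≈0 x 5∣x) e
    go (⊕ ∷ ⊕ ∷ ⊖ ∷ [] , refl , e) = ≉-mod x 0ℤ 1ℤ 5 (∣⇒≈0 x 5∣x) e
    go (⊕ ∷ ⊖ ∷ ⊕ ∷ [] , refl , e) = ≉-mod x 0ℤ 1ℤ 5 (∣⇒≈0 x 5∣x) e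
    go (⊕ ∷ ⊖ ∷ ⊖ ∷ [] , refl , e) = ≉-mod x 0ℤ -1ℤ 5 (∣⇒≈0 x 5∣x) e
    go (⊖ ∷ ⊕ ∷ ⊕ ∷ [] , refl , e) = ≉-mod x 0ℤ 1ℤ 5 (∣⇒≈0 x 5∣x) e
    go (⊖ ∷ ⊕ ∷ ⊖ ∷ [] , refl , e) = ≉-mod x 0ℤ -1ℤ 5 (∣⇒≈0 x 5∣x) e
    go (⊖ ∷ ⊖ ∷ ⊕ ∷ [] , refl , e) = ≉-mod x 0ℤ -1ℤ 5 (∣⇒≈0 x 5∣x) e
    go (⊖ ∷ ⊖ ∷ ⊖ ∷ [] , refl , e) = ≉-mod x 0ℤ (- (+ 3)) 5 (∣⇒≈0 x 5∣x) e

  -- Equal signs are impossible at `p`, and opposite signs sum to 0 instead of 1 at 3.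
  ¬Rep-mod3-2 : ∀ {p} → Prime p → p ℕ.% 4 ≡ 3 → ∀ {s t x} → x ≈ 1ℤ mod + 3 → + p ∣ x →
    Rep (+ 3) (s ∷ t ∷ []) x → ¬ Rep (+ p) (s ∷ t ∷ []) x
  ¬Rep-mod3-2 pp p%4 {⊕} {⊕} x≈1 p∣x r₃ rₚ = ¬Rep-pair pp p%4 p∣x rₚ
  ¬Rep-mod3-2 pp p%4 {⊖} {⊖} x≈1 p∣x r₃ rₚ = ¬Rep-pair pp p%4 p∣x rₚ
  ¬Rep-mod3-2 pp p%4 {⊕} {⊖} {x} x≈1 p∣x r₃ rₚ = ≉-mod x 1ℤ 0ℤ 3 x≈1 (Rep-mod3 r₃)
  ¬Rep-mod3-2 pp p%4 {⊖} {⊕} {x} x≈1 p∣x r₃ rₚ = ≉-mod x 1ℤ 0ℤ 3 x≈1 (Rep-mod3 r₃)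

  -- Lower and upper bounds for the number of terms.

  module _ (n : ℕ) .{{_ : ℕ.NonZero n}} (odd : ¬ (2 ℕ.∣ n)) where

    Lower Upper : ℕ → Set
    Lower D = ∃[ x ] (∀ σ → Rep (+ n) σ x → D ℕ.≤ length σ)
    Upper D = ∀ x → ∃[ σ ] (length σ ℕ.≤ D × Rep (+ n) σ x)

    at : ∀ {p σ x} → p ℕ.∣ n → Rep (+ n) σ x → Rep (+ p) σ x
    at p∣n = Rep-∣ (∣ᵤ⇒∣⁺ p∣n)

    lower₁ : 1 ℕ.< n → Lower 1
    lower₁ 1<n = 1ℤ , λ
      { []      r → ⊥-elim (ℕ.<⇒≢ 1<n (sym (ℕ.∣1⇒≡1 (∣⇒∣ᵤ (Rep[]⇒∣ r)))))
      ; (_ ∷ _) r → ℕ.s≤s ℕ.z≤n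
      }

    -- The difference `p` is nonzero modulo `n` but not a unit, so neither no term nor one term
    -- represents it.
    lower₂ : ∀ {p} → Prime p → p ℕ.∣ n → ¬ (n ℕ.∣ p) → Lower 2
    lower₂ {p} pp p∣n n∤p = + p , λ
      { []          r → ⊥-elim (n∤p (∣⇒∣ᵤ (Rep[]⇒∣ r)))
      ; (_ ∷ [])    r → ⊥-elim (¬Rep-singleton pp ∣-refl (at p∣n r))
      ; (_ ∷ _ ∷ _) r → ℕ.s≤s (ℕ.s≤s ℕ.z≤n)
      }

    lower₃-mod5 : 5 ℕ.∣ n → ∀ {q} → Prime q → q ℕ.∣ n → ¬ (5 ≡ q) → Lower 3
    lower₃-mod5 5∣n {q} qp q∣n 5≢q =
      let x , x≈1 , q∣x = oneModulo prime[5] (+ q) (prime∤prime prime[5] qp 5≢q) in x , λ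
      { []              r → ⊥-elim (1≉0 prime[5] x≈1 (Rep[]⇒∣ (at 5∣n r)))
      ; (_ ∷ [])        r → ⊥-elim (¬Rep-singleton qp q∣x (at q∣n r))
      ; (_ ∷ _ ∷ [])    r → ⊥-elim (¬Rep-mod5-2 x≈1 (at 5∣n r))
      ; (_ ∷ _ ∷ _ ∷ _) r → ℕ.s≤s (ℕ.s≤s (ℕ.s≤s ℕ.z≤n))
      }

    lower₃-mod3 : 3 ℕ.∣ n → ∀ {p} → Prime p → p ℕ.∣ n → ¬ (3 ≡ p) → p ℕ.% 4 ≡ 3 → Lower 3
    lower₃-mod3 3∣n {p} pp p∣n 3≢p p%4 =
      let x , x≈1 , p∣x = oneModulo prime[3] (+ p) (prime∤prime prime[3] pp 3≢p) in x , λ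
      { []              r → ⊥-elim (1≉0 prime[3] x≈1 (Rep[]⇒∣ (at 3∣n r)))
      ; (_ ∷ [])        r → ⊥-elim (¬Rep-singleton pp p∣x (at p∣n r))
      ; (_ ∷ _ ∷ [])    r → ⊥-elim (¬Rep-mod3-2 pp p%4 x≈1 p∣x (at 3∣n r) (at p∣n r))
      ; (_ ∷ _ ∷ _ ∷ _) r → ℕ.s≤s (ℕ.s≤s (ℕ.s≤s ℕ.z≤n))
      }

    -- The difference is 1 modulo 3 and 0 modulo 5p. One term fails at `p`, two terms fail at 3 and
    -- `p` jointly, and three terms fail at 5.
    lower₄ : 3 ℕ.∣ n → 5 ℕ.∣ n → ∀ {p} → Prime p → p ℕ.∣ n → ¬ (3 ≡ p) → p ℕ.% 4 ≡ 3 → Lower 4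
    lower₄ 3∣n 5∣n {p} pp p∣n 3≢p p%4 =
      let x , x≈1 , 5p∣x = oneModulo prime[3] (+ 5 * + p) 3∤5p
          5∣x = ∣-trans (divides (+ p) (comm (+ p))) 5p∣x
          p∣x = ∣-trans (divides (+ 5) refl) 5p∣x
      in x , λ
      { []                  r → ⊥-elim (1≉0 prime[3] x≈1 (Rep[]⇒∣ (at 3∣n r)))
      ; (_ ∷ [])            r → ⊥-elim (¬Rep-singleton pp p∣x (at p∣n r))
      ; (_ ∷ _ ∷ [])        r → ⊥-elim (¬Rep-mod3-2 pp p%4 x≈1 p∣x (at 3∣n r) (at p∣n r))
      ; (_ ∷ _ ∷ _ ∷ [])    r → ⊥-elim (¬Rep-mod5-3 5∣x (at 5∣n r))
      ; (_ ∷ _ ∷ _ ∷ _ ∷ _) r → ℕ.s≤s (ℕ.s≤s (ℕ.s≤s (ℕ.s≤s ℕ.z≤n)))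
      }
      where
      comm : ∀ p → + 5 * p ≡ p * + 5
      comm = solve-∀
      3∤5p : ¬ (+ 3 ∣ + 5 * + p)
      3∤5p d with euclid prime[3] (+ 5) (+ p) d
      ... | inj₁ 3∣5 = prime∤prime prime[3] prime[5] (λ ()) 3∣5
      ... | inj₂ 3∣p = prime∤prime prime[3] pp 3≢p 3∣p

    At3 At5 Others : List Sign → ℤ → Set
    At3 σ x    = 3 ℕ.∣ n → Rep (+ 3) σ x
    At5 σ x    = 5 ℕ.∣ n → Rep (+ 5) σ x
    Others σ x = ∀ p → Prime p → p ℕ.∣ n → ¬ (p ≡ 3) → ¬ (p ≡ 5) → Rep (+ p) σ x

    combine : ∀ s σ x → At3 (s ∷ σ) x → At5 (s ∷ σ) x → Others (s ∷ σ) x → Rep (+ n) (s ∷ σ) x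
    combine s σ x at3 at5 others = localRep n odd s σ x local
      where
      local : ∀ p → Prime p → p ℕ.∣ n → Rep (+ p) (s ∷ σ) x
      local p pp p∣n with p ℕ.≟ 3 | p ℕ.≟ 5
      ... | yes refl | _        = at3 p∣n
      ... | no  _    | yes refl = at5 p∣n
      ... | no  p≢3  | no p≢5   = others p pp p∣n p≢3 p≢5

    others⊕⊖ : ∀ x → Others (⊕ ∷ ⊖ ∷ []) x
    others⊕⊖ x p pp p∣n p≢3 p≢5 = difference pp (λ { refl → odd p∣n }) p≢3 p≢5 x

    others∷ : ∀ s {σ} → (∀ x → Others σ x) → ∀ x → Others (s ∷ σ) x
    others∷ s others x p pp p∣n p≢3 p≢5 = Rep-1∷ s x (others _ p pp p∣n p≢3 p≢5)

    -- Every prime divisor of `n` other than 3 is 1 modulo 4 here, so the signs can be chosen to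
    -- suit the residue modulo 3 alone.
    module 3mod4-only3 (only : ∀ p → Prime p → p ℕ.∣ n → ¬ (p ≡ 3) → ¬ (p ℕ.% 4 ≡ 3)) where

      others-signs : ∀ {σ} τ → length σ ≡ length τ → (∀ x → Others σ x) → ∀ x → Others τ x
      others-signs τ eq others x p pp p∣n p≢3 p≢5 with odd%4 p (λ 2∣p → odd (ℕ.∣-trans 2∣p p∣n))
      ... | inj₂ p%4 = ⊥-elim (only p pp p∣n p≢3 p%4)
      ... | inj₁ p%4 = let i , i²≈-1 = 1mod4.√-1 pp p%4 in
        Rep-signs pp i i²≈-1 τ eq (others x p pp p∣n p≢3 p≢5)

      two : ∀ τ {x} → length τ ≡ 2 → Others τ x
      two τ {x} eq = others-signs τ (sym eq) others⊕⊖ x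

      three : ∀ τ {x} → length τ ≡ 3 → Others τ x
      three τ {x} eq = others-signs τ (sym eq) (others∷ ⊕ others⊕⊖) x

      -- The sums 0, -2 and 2 of two signs cover all residues modulo 3. The condition at 5 is asked
      -- for every list of length 2, because the signs are chosen only here.
      sum₂ : ∀ x → (∀ σ → length σ ≡ 2 → At5 σ x) → ∃[ σ ] (length σ ≡ 2 × Rep (+ n) σ x)
      sum₂ x at5 = go (mod3 x)
        where
        go : Mod3 x → ∃[ σ ] (length σ ≡ 2 × Rep (+ n) σ x)
        go (0mod3 e) = ⊕ ∷ ⊖ ∷ [] , refl , combine ⊕ (⊖ ∷ []) x
          (λ _ → Rep-sum _ x e) (at5 _ refl) (two _ refl)
        go (1mod3 e) = ⊖ ∷ ⊖ ∷ [] , refl , combine ⊖ (⊖ ∷ []) x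
          (λ _ → Rep-sum _ x (≈-trans x 1ℤ (- (+ 2)) e (divides 1ℤ refl))) (at5 _ refl) (two _ refl)
        go (2mod3 e) = ⊕ ∷ ⊕ ∷ [] , refl , combine ⊕ (⊕ ∷ []) x
          (λ _ → Rep-sum _ x (≈-trans x -1ℤ (+ 2) e (divides -1ℤ refl))) (at5 _ refl) (two _ refl)

      sum₃ : ∀ x → (∀ σ → length σ ≡ 3 → At5 σ x) → ∃[ σ ] (length σ ≡ 3 × Rep (+ n) σ x)
      sum₃ x at5 = go (mod3 x)
        where
        go : Mod3 x → ∃[ σ ] (length σ ≡ 3 × Rep (+ n) σ x)
        go (0mod3 e) = ⊕ ∷ ⊕ ∷ ⊕ ∷ [] , refl , combine ⊕ (⊕ ∷ ⊕ ∷ []) x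
          (λ _ → Rep-sum _ x (≈-trans x 0ℤ (+ 3) e (divides -1ℤ refl))) (at5 _ refl) (three _ refl)
        go (1mod3 e) = ⊕ ∷ ⊕ ∷ ⊖ ∷ [] , refl , combine ⊕ (⊕ ∷ ⊖ ∷ []) x
          (λ _ → Rep-sum _ x e) (at5 _ refl) (three _ refl)
        go (2mod3 e) = ⊕ ∷ ⊖ ∷ ⊖ ∷ [] , refl , combine ⊕ (⊖ ∷ ⊖ ∷ []) x
          (λ _ → Rep-sum _ x e) (at5 _ refl) (three _ refl)

      upper₂-without5 : ¬ (5 ℕ.∣ n) → Upper 2
      upper₂-without5 5∤n x = let σ , len , r = sum₂ x (λ _ _ 5∣n → ⊥-elim (5∤n 5∣n)) in
        σ , ℕ.≤-reflexive len , r

      -- The residue modulo 5 dictates the length, two for 0 and ± 2, three for ± 1; the residue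
      -- modulo 3 then dictates the signs.
      upper₃-only3 : Upper 3
      upper₃-only3 x = go (mod5 x)
        where
        short : ∀ τ → length τ ≡ 2 → x ≈ sum τ mod + 5 → ∃[ σ ] (length σ ℕ.≤ 3 × Rep (+ n) σ x)
        short τ len e = let σ , len′ , r = sum₂ x (λ σ eq _ → Rep5-sum τ (trans len (sym eq)) e)
          in σ , ℕ.≤-trans (ℕ.≤-reflexive len′) (ℕ.n≤1+n 2) , r
        long : ∀ τ → length τ ≡ 3 → x ≈ sum τ mod + 5 → ∃[ σ ] (length σ ℕ.≤ 3 × Rep (+ n) σ x)
        long τ len e = let σ , len′ , r = sum₃ x (λ σ eq _ → Rep5-sum τ (trans len (sym eq)) e)
          in σ , ℕ.≤-reflexive len′ , r
        go : Mod5 x → ∃[ σ ] (length σ ℕ.≤ 3 × Rep (+ n) σ x)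
        go (0mod5 e) = short (⊕ ∷ ⊖ ∷ []) refl e
        go (1mod5 e) = long (⊕ ∷ ⊕ ∷ ⊖ ∷ []) refl e
        go (2mod5 e) = short (⊕ ∷ ⊕ ∷ []) refl e
        go (3mod5 e) = short (⊖ ∷ ⊖ ∷ []) refl (≈-trans x (+ 3) (- (+ 2)) e (divides 1ℤ refl))
        go (4mod5 e) = long (⊕ ∷ ⊖ ∷ ⊖ ∷ []) refl (≈-trans x (+ 4) -1ℤ e (divides 1ℤ refl))

    upper₂ : ¬ (3 ℕ.∣ n) → ¬ (5 ℕ.∣ n) → Upper 2
    upper₂ 3∤n 5∤n x = ⊕ ∷ ⊖ ∷ [] , ℕ.≤-refl ,
      combine ⊕ (⊖ ∷ []) x (λ 3∣n → ⊥-elim (3∤n 3∣n)) (λ 5∣n → ⊥-elim (5∤n 5∣n)) (others⊕⊖ x)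

    upper₃-without3 : ¬ (3 ℕ.∣ n) → Upper 3
    upper₃-without3 3∤n x = go (mod5 x)
      where
      short : ∀ τ → length τ ≡ 2 → x ≈ sum τ mod + 5 → ∃[ σ ] (length σ ℕ.≤ 3 × Rep (+ n) σ x)
      short τ len e = ⊕ ∷ ⊖ ∷ [] , ℕ.n≤1+n 2 ,
        combine ⊕ (⊖ ∷ []) x (λ 3∣n → ⊥-elim (3∤n 3∣n)) (λ _ → Rep5-sum τ len e) (others⊕⊖ x)
      long : ∀ τ → length τ ≡ 3 → x ≈ sum τ mod + 5 → ∃[ σ ] (length σ ℕ.≤ 3 × Rep (+ n) σ x)
      long τ len e = ⊕ ∷ ⊕ ∷ ⊖ ∷ [] , ℕ.≤-refl ,
        combine ⊕ (⊕ ∷ ⊖ ∷ []) x (λ 3∣n → ⊥-elim (3∤n 3∣n)) (λ _ → Rep5-sum τ len e) (others∷ ⊕ others⊕⊖ x)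
      go : Mod5 x → ∃[ σ ] (length σ ℕ.≤ 3 × Rep (+ n) σ x)
      go (0mod5 e) = short (⊕ ∷ ⊖ ∷ []) refl e
      go (1mod5 e) = long (⊕ ∷ ⊕ ∷ ⊖ ∷ []) refl e
      go (2mod5 e) = short (⊕ ∷ ⊕ ∷ []) refl e
      go (3mod5 e) = short (⊖ ∷ ⊖ ∷ []) refl (≈-trans x (+ 3) (- (+ 2)) e (divides 1ℤ refl))
      go (4mod5 e) = long (⊕ ∷ ⊖ ∷ ⊖ ∷ []) refl (≈-trans x (+ 4) -1ℤ e (divides 1ℤ refl))

    -- The final `⊕ ∷ ⊖` represents everything at the primes above 5 and contributes 0 at 3, so a
    -- leading sign can adjust the residue modulo 3.
    upper₃-without5 : ¬ (5 ℕ.∣ n) → Upper 3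
    upper₃-without5 5∤n x = go (mod3 x)
      where
      no5 : ∀ {A : Set} → 5 ℕ.∣ n → A
      no5 5∣n = ⊥-elim (5∤n 5∣n)
      go : Mod3 x → ∃[ σ ] (length σ ℕ.≤ 3 × Rep (+ n) σ x)
      go (0mod3 e) = ⊕ ∷ ⊖ ∷ [] , ℕ.n≤1+n 2 , combine ⊕ (⊖ ∷ []) x (λ _ → Rep-sum _ x e) no5 (others⊕⊖ x)
      go (1mod3 e) = ⊕ ∷ ⊕ ∷ ⊖ ∷ [] , ℕ.≤-refl ,
        combine ⊕ (⊕ ∷ ⊖ ∷ []) x (λ _ → Rep-sum _ x e) no5 (others∷ ⊕ others⊕⊖ x)
      go (2mod3 e) = ⊖ ∷ ⊕ ∷ ⊖ ∷ [] , ℕ.≤-refl ,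
        combine ⊖ (⊕ ∷ ⊖ ∷ []) x (λ _ → Rep-sum _ x e) no5 (others∷ ⊖ others⊕⊖ x)

    upper₄ : Upper 4
    upper₄ x = go (mod3 x)
      where
      -- The sums 0, ± 2 and ± 4 of four signs cover all residues modulo 5, so length 4 always
      -- serves at 5 and the signs remain free for 3.
      at5 : ∀ σ → length σ ≡ 4 → Mod5 x → At5 σ x
      at5 σ eq (0mod5 e) _ = Rep5-sum (⊕ ∷ ⊖ ∷ ⊕ ∷ ⊖ ∷ []) (sym eq) e
      at5 σ eq (1mod5 e) _ = Rep5-sum (⊖ ∷ ⊖ ∷ ⊖ ∷ ⊖ ∷ []) (sym eq)
        (≈-trans x 1ℤ (- (+ 4)) e (divides 1ℤ refl))
      at5 σ eq (2mod5 e) _ = Rep5-sum (⊕ ∷ ⊕ ∷ ⊕ ∷ ⊖ ∷ []) (sym eq) e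
      at5 σ eq (3mod5 e) _ = Rep5-sum (⊖ ∷ ⊖ ∷ ⊖ ∷ ⊕ ∷ []) (sym eq)
        (≈-trans x (+ 3) (- (+ 2)) e (divides 1ℤ refl))
      at5 σ eq (4mod5 e) _ = Rep5-sum (⊕ ∷ ⊕ ∷ ⊕ ∷ ⊕ ∷ []) (sym eq) e
      go : Mod3 x → ∃[ σ ] (length σ ℕ.≤ 4 × Rep (+ n) σ x)
      go (0mod3 e) = ⊕ ∷ ⊖ ∷ ⊕ ∷ ⊖ ∷ [] , ℕ.≤-refl , combine ⊕ (⊖ ∷ ⊕ ∷ ⊖ ∷ []) x
        (λ _ → Rep-sum _ x e) (at5 _ refl (mod5 x)) (others∷ ⊕ (others∷ ⊖ others⊕⊖) x)
      go (1mod3 e) = ⊖ ∷ ⊖ ∷ ⊕ ∷ ⊖ ∷ [] , ℕ.≤-refl , combine ⊖ (⊖ ∷ ⊕ ∷ ⊖ ∷ []) x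
        (λ _ → Rep-sum _ x (≈-trans x 1ℤ (- (+ 2)) e (divides 1ℤ refl)))
        (at5 _ refl (mod5 x)) (others∷ ⊖ (others∷ ⊖ others⊕⊖) x)
      go (2mod3 e) = ⊕ ∷ ⊕ ∷ ⊕ ∷ ⊖ ∷ [] , ℕ.≤-refl , combine ⊕ (⊕ ∷ ⊕ ∷ ⊖ ∷ []) x
        (λ _ → Rep-sum _ x (≈-trans x -1ℤ (+ 2) e (divides -1ℤ refl)))
        (at5 _ refl (mod5 x)) (others∷ ⊕ (others∷ ⊕ others⊕⊖) x)

    Rep-primePower : ∀ p → (∀ q → Prime q → q ℕ.∣ n → q ≡ p) → ∀ s σ x →
      x ≈ sum (s ∷ σ) mod + p → Rep (+ n) (s ∷ σ) x
    Rep-primePower p only s σ x e = localRep n odd s σ x λ q qp q∣n →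
      subst (λ q → Rep (+ q) (s ∷ σ) x) (sym (only q qp q∣n)) (Rep-sum _ x e)

    -- Modulo 3 and 5 every residue is a sum of one or two signs. The residue 0 is written as 1 - 1
    -- and not as the empty sum, because `x` need not vanish modulo `n`.
    upper₂-primePower : ∀ p → (∀ q → Prime q → q ℕ.∣ n → q ≡ p) → Upper 2
    upper₂-primePower p only x with p ℕ.≟ 3 | p ℕ.≟ 5
    ... | no p≢3   | no p≢5   = upper₂
      (λ 3∣n → p≢3 (sym (only 3 prime[3] 3∣n))) (λ 5∣n → p≢5 (sym (only 5 prime[5] 5∣n))) x
    ... | yes refl | _        = go (mod3 x)
      where
      go : Mod3 x → ∃[ σ ] (length σ ℕ.≤ 2 × Rep (+ n) σ x)
      go (0mod3 e) = _ , ℕ.≤-refl , Rep-primePower 3 only ⊕ (⊖ ∷ []) x e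
      go (1mod3 e) = _ , ℕ.n≤1+n 1 , Rep-primePower 3 only ⊕ [] x e
      go (2mod3 e) = _ , ℕ.n≤1+n 1 , Rep-primePower 3 only ⊖ [] x e
    ... | no _     | yes refl = go (mod5 x)
      where
      go : Mod5 x → ∃[ σ ] (length σ ℕ.≤ 2 × Rep (+ n) σ x)
      go (0mod5 e) = _ , ℕ.≤-refl , Rep-primePower 5 only ⊕ (⊖ ∷ []) x e
      go (1mod5 e) = _ , ℕ.n≤1+n 1 , Rep-primePower 5 only ⊕ [] x e
      go (2mod5 e) = _ , ℕ.≤-refl , Rep-primePower 5 only ⊕ (⊕ ∷ []) x e
      go (3mod5 e) = _ , ℕ.≤-refl , Rep-primePower 5 only ⊖ (⊖ ∷ []) x
        (≈-trans x (+ 3) (- (+ 2)) e (divides 1ℤ refl))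
      go (4mod5 e) = _ , ℕ.n≤1+n 1 , Rep-primePower 5 only ⊖ [] x
        (≈-trans x (+ 4) -1ℤ e (divides 1ℤ refl))

    -- The diameter in each case.

    diameter : ∀ {D} → Lower D → Upper D → IsDiameter (G n) D
    diameter lower upper = isDiameter-Rep n _ upper lower

    diameter-prime3 : 1 ℕ.< n → Prime n → n ℕ.% 4 ≡ 3 → IsDiameter (G n) 1
    diameter-prime3 1<n np n%4 = diameter (lower₁ 1<n) λ x → go x (+ n ∣? x)
      where
      eq₁ : ∀ x q → x - 1ℤ * q ≡ -1ℤ * (q - x)
      eq₁ = solve-∀
      eq₂ : ∀ x q → x - -1ℤ * q ≡ 1ℤ * (q + x)
      eq₂ = solve-∀
      eq₃ : ∀ x q → q - - x ≡ 1ℤ * (q + x)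
      eq₃ = solve-∀
      eq₄ : ∀ x → x ≡ -1ℤ * - x
      eq₄ = solve-∀
      signed : ∀ x → ¬ (+ n ∣ x) → ∃[ u ] (+ n ∣ u * u - x ⊎ + n ∣ u * u + x) →
        ∃[ σ ] (length σ ℕ.≤ 1 × Rep (+ n) σ x)
      signed x n∤x (u , inj₁ e) = ⊕ ∷ [] , ℕ.≤-refl , term u (unit-root np x u n∤x e)
        (done (∣-multiple -1ℤ e (eq₁ x (u * u))))
      signed x n∤x (u , inj₂ e) = ⊖ ∷ [] , ℕ.≤-refl ,
        term u (unit-root np (- x) u (λ n∣-x → n∤x (∣-multiple -1ℤ n∣-x (eq₄ x)))
          (∣-multiple 1ℤ e (eq₃ x (u * u))))
        (done (∣-multiple 1ℤ e (eq₂ x (u * u))))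
      go : ∀ x → Dec (+ n ∣ x) → ∃[ σ ] (length σ ℕ.≤ 1 × Rep (+ n) σ x)
      go x (yes n∣x) = [] , ℕ.z≤n , done n∣x
      go x (no  n∤x) = signed x n∤x (3mod4.±square np n%4 x n∤x)

    -- A nonsquare is not a single signed square, because -1 is a square and the sign can be changed
    -- to `⊕`.
    diameter-prime1 : Prime n → n ℕ.% 4 ≡ 1 → IsDiameter (G n) 2
    diameter-prime1 np n%4 =
      let a , n∤a , ¬root = 1mod4.nonsquare np n%4
          i , i²≈-1 = 1mod4.√-1 np n%4
      in diameter
      (a , λ { []          r → ⊥-elim (n∤a (Rep[]⇒∣ r))
             ; (s ∷ [])    r → ⊥-elim (notSquare a ¬root (Rep-signs np i i²≈-1 (⊕ ∷ []) refl r))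
             ; (_ ∷ _ ∷ _) r → ℕ.s≤s (ℕ.s≤s ℕ.z≤n) })
      (upper₂-primePower n λ q qp q∣n → ∣prime⇒≡ qp np q∣n)
      where
      eq : ∀ x q → q - x ≡ -1ℤ * (x - 1ℤ * q)
      eq = solve-∀
      notSquare : ∀ a → (∀ u → ¬ (+ n ∣ u * u - a)) → ¬ Rep (+ n) (⊕ ∷ []) a
      notSquare a ¬root (term u _ (done e)) = ¬root u (∣-multiple -1ℤ e (eq a (u * u)))

    diameter-primePower : ω n ≡ 1 → Composite n → IsDiameter (G n) 2
    diameter-primePower ω≡1 composite =
      let p , pp , p∣n , only = uniquePrimeFactor n ω≡1 in
      diameter (lower₂ pp p∣n (λ n∣p → composite⇒¬prime composite (subst Prime (ℕ.∣-antisym p∣n n∣p) pp)))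
        (upper₂-primePower p only)

    module _ (1<ω : 1 ℕ.< ω n) where
      private
        lower₂-ω : Lower 2
        lower₂-ω = let p , q , pp , p∣n , qp , q∣n , p≢q = twoPrimeFactors n 1<ω in
          lower₂ pp p∣n λ n∣p → p≢q (sym (∣prime⇒≡ qp pp (ℕ.∣-trans q∣n n∣p)))

        lower₃-ω : 5 ℕ.∣ n → Lower 3
        lower₃-ω 5∣n with twoPrimeFactors n 1<ω
        ... | p , q , pp , p∣n , qp , q∣n , p≢q with 5 ℕ.≟ p
        ...   | no  5≢p  = lower₃-mod5 5∣n pp p∣n 5≢p
        ...   | yes refl = lower₃-mod5 5∣n qp q∣n p≢q

        Large3mod4 : ℕ → Set
        Large3mod4 p = 3 ℕ.< p × p ℕ.% 4 ≡ 3

        δ? : Dec (Any Large3mod4 (primeFactors n))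
        δ? = any? (λ p → 3 ℕ.<? p ×-dec p ℕ.% 4 ℕ.≟ 3) (primeFactors n)

        largeFactor : Any Large3mod4 (primeFactors n) → ∃[ p ] (Prime p × p ℕ.∣ n × ¬ (3 ≡ p) × p ℕ.% 4 ≡ 3)
        largeFactor any = let p , p∈ , 3<p , p%4 = find any ; pp , p∣n = ∈primeFactors⁻ n p∈
          in p , pp , p∣n , ℕ.<⇒≢ 3<p , p%4

        onlySmall : ¬ Any Large3mod4 (primeFactors n) → ∀ p → Prime p → p ℕ.∣ n → ¬ (p ≡ 3) → ¬ (p ℕ.% 4 ≡ 3)
        onlySmall ¬any p pp p∣n p≢3 p%4 = ¬any (lose (∈primeFactors⁺ n pp p∣n) (large p p%4 p≢3 , p%4))
          where
          large : ∀ p → p ℕ.% 4 ≡ 3 → ¬ (p ≡ 3) → 3 ℕ.< p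
          large 3 _ p≢3 = ⊥-elim (p≢3 refl)
          large (suc (suc (suc (suc p)))) _ _ = ℕ.s≤s (ℕ.s≤s (ℕ.s≤s (ℕ.s≤s ℕ.z≤n)))

      diameter-ω : IsDiameter (G n) (2 ℕ.+ γ₃ n ℕ.* δ₃ n ℕ.+ γ₅ n) × 2 ℕ.+ γ₃ n ℕ.* δ₃ n ℕ.+ γ₅ n ℕ.≤ 4
      diameter-ω = cases (3 ℕ.∣? n) (5 ℕ.∣? n) δ?
        where
        Goal : ℕ → Set
        Goal D = IsDiameter (G n) D × D ℕ.≤ 4
        by : ∀ {a b c} → γ₃ n ≡ a → δ₃ n ≡ b → γ₅ n ≡ c →
          Goal (2 ℕ.+ a ℕ.* b ℕ.+ c) → Goal (2 ℕ.+ γ₃ n ℕ.* δ₃ n ℕ.+ γ₅ n)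
        by γ₃≡ δ₃≡ γ₅≡ = subst Goal (sym (cong₂ (λ d c → 2 ℕ.+ d ℕ.+ c) (cong₂ ℕ._*_ γ₃≡ δ₃≡) γ₅≡))
        2≤4 : 2 ℕ.≤ 4
        2≤4 = ℕ.m≤m+n 2 2
        cases : Dec (3 ℕ.∣ n) → Dec (5 ℕ.∣ n) → Dec (Any Large3mod4 (primeFactors n)) →
          Goal (2 ℕ.+ γ₃ n ℕ.* δ₃ n ℕ.+ γ₅ n)
        cases (no 3∤n) (no 5∤n) _ =
          -- `δ₃ n` stays undetermined: its product with 0 reduces to 0.
          by (indicator-no (3 ℕ.∣? n) 3∤n) refl (indicator-no (5 ℕ.∣? n) 5∤n)
            (diameter lower₂-ω (upper₂ 3∤n 5∤n) , 2≤4)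
        cases (no 3∤n) (yes 5∣n) _ =
          by (indicator-no (3 ℕ.∣? n) 3∤n) refl (indicator-yes (5 ℕ.∣? n) 5∣n)
            (diameter (lower₃-ω 5∣n) (upper₃-without3 3∤n) , ℕ.n≤1+n 3)
        cases (yes 3∣n) (no 5∤n) (no ¬large) =
          by (indicator-yes (3 ℕ.∣? n) 3∣n) (indicator-no δ? ¬large) (indicator-no (5 ℕ.∣? n) 5∤n)
            (diameter lower₂-ω (3mod4-only3.upper₂-without5 (onlySmall ¬large) 5∤n) , 2≤4)
        cases (yes 3∣n) (no 5∤n) (yes large) =
          let p , pp , p∣n , 3≢p , p%4 = largeFactor large in
          by (indicator-yes (3 ℕ.∣? n) 3∣n) (indicator-yes δ? large) (indicator-no (5 ℕ.∣? n) 5∤n)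
            (diameter (lower₃-mod3 3∣n pp p∣n 3≢p p%4) (upper₃-without5 5∤n) , ℕ.n≤1+n 3)
        cases (yes 3∣n) (yes 5∣n) (no ¬large) =
          by (indicator-yes (3 ℕ.∣? n) 3∣n) (indicator-no δ? ¬large) (indicator-yes (5 ℕ.∣? n) 5∣n)
            (diameter (lower₃-ω 5∣n) (3mod4-only3.upper₃-only3 (onlySmall ¬large)) , ℕ.n≤1+n 3)
        cases (yes 3∣n) (yes 5∣n) (yes large) =
          let p , pp , p∣n , 3≢p , p%4 = largeFactor large in
          by (indicator-yes (3 ℕ.∣? n) 3∣n) (indicator-yes δ? large) (indicator-yes (5 ℕ.∣? n) 5∣n)
            (diameter (lower₄ 3∣n 5∣n pp p∣n 3≢p p%4) upper₄ , ℕ.≤-refl)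

    -- The cases of the formula are exhaustive: an odd prime is 1 or 3 modulo 4, and `ω n` cannot be
    -- 0 because `n > 1` has a prime divisor.
    diameter≤4 : 1 ℕ.< n → ∃[ d ] (IsDiameter (G n) d × d ℕ.≤ 4)
    diameter≤4 1<n = go (ω n) refl (prime? n) (odd%4 n odd)
      where
      instance _ = ℕ.n>1⇒nonTrivial 1<n
      go : ∀ k → ω n ≡ k → Dec (Prime n) → n ℕ.% 4 ≡ 1 ⊎ n ℕ.% 4 ≡ 3 → ∃[ d ] (IsDiameter (G n) d × d ℕ.≤ 4)
      go _ _ (yes np) (inj₁ n%4) = 2 , diameter-prime1 np n%4 , ℕ.m≤m+n 2 2
      go _ _ (yes np) (inj₂ n%4) = 1 , diameter-prime3 1<n np n%4 , ℕ.m≤m+n 1 3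
      go zero          ω≡ (no _)   _ = let p , pp , p∣n = primeDivisor n 1<n in
        ⊥-elim (empty (primeFactors n) ω≡ (∈primeFactors⁺ n pp p∣n))
        where
        empty : ∀ ps {p} → length ps ≡ 0 → ¬ (p ∈ ps)
        empty [] _ ()
      go (suc zero)    ω≡ (no ¬np) _ = 2 , diameter-primePower ω≡ (¬prime⇒composite ¬np) , ℕ.m≤m+n 2 2
      go (suc (suc k)) ω≡ (no _)   _ = _ , diameter-ω (subst (1 ℕ.<_) (sym ω≡) (ℕ.s≤s (ℕ.s≤s ℕ.z≤n)))

open Diameters
open import Defs
open import Data.Nat using (ℕ; _+_; _*_; _%_; _<_; _≤_; NonZero)
open import Data.Nat.Divisibility using (_∣_)
open import Data.Nat.Primality using (Prime; Composite)
open import Data.Product using (_×_; _,_; proj₁; ∃-syntax)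
open import Relation.Binary.PropositionalEquality using (_≡_)
open import Relation.Nullary using (¬_)

theorem6 : (n : ℕ) .{{_ : NonZero n}} → 1 < n → ¬ (2 ∣ n) →
    (Prime n → n % 4 ≡ 3 → IsDiameter (G n) 1) ×
    (Prime n → n % 4 ≡ 1 → IsDiameter (G n) 2) ×
    (ω n ≡ 1 → Composite n → IsDiameter (G n) 2) ×
    (1 < ω n → IsDiameter (G n) (2 + γ₃ n * δ₃ n + γ₅ n)) ×
    (∃[ d ] (IsDiameter (G n) d × d ≤ 4))
theorem6 n 1<n odd =
  diameter-prime3 n odd 1<n ,
  diameter-prime1 n odd ,
  diameter-primePower n odd ,
  (λ 1<ω → proj₁ (diameter-ω n odd 1<ω)) ,
  diameter≤4 n odd 1<n
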